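{- Let $n\ge 7$ be an integer. Then $$\Theta(n)=[s(n-1)+1]\cup\{\mathrm{LCM}(p,q): p+q=n,\ p,q\in\mathbb{Z}^+\}\cup\{\infty\},$$ where $\Theta(n)$ is the set of stable indices of all 0-1 matrices of order $n$, $s(n-1)$ is the maximum finite stable index of 0-1 matrices of order $n-1$, and $[k]=\{1,2,\ldots,k\}$.
   Context: $\mathbb{Z}^+$ is the set of positive integers, $[k]=\{1,2,\ldots,k\}$ for $k\in\mathbb{Z}^+$, and $\mathrm{LCM}(p,q)$ is the least common multiple of $p$ and $q$. A 0-1 matrix of order $n$ is an $n\times n$ matrix all of whose entries lie in $\{0,1\}$; matrix powers are taken over the integers. Stable index: for a square 0-1 matrix $A$, the stable index $\theta(A)$ is the smallest positive integer $k$ such that $A^{k+1}$ is not a 0-1 matrix, if such an integer exists; otherwise $\theta(A)=\infty$. $\Theta(n)=\{\theta(A): A \text{ is a 0-1 matrix of order } n\}$, and $s(n)$ denotes the maximum finite stable index of 0-1 matrices of order $n$, i.e. $s(n)=\max\big(\Theta(n)\setminus\{\infty\}\big)$ (this maximum exists since there are only finitely many 0-1 matrices of order $n$). -}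

module Defs where

open import Algebra.Properties.Semiring.Sum as Sum using ()
open import Data.Empty using (⊥)
open import Data.Fin.Base as Fin using (Fin; zero; suc; toℕ; funToFin; finToFun)
open import Data.Fin.Properties as Fin using (all?; pigeonhole; finToFun-funToFin; toℕ<n)
open import Data.Integer.Base as ℤ using (ℤ; +_; 0ℤ; 1ℤ)
import Data.Integer.Properties as ℤ
open import Data.List.Base using (map; allFin)
open import Data.List.Extrema.Nat using (max; argmax-sel; xs≤max)
open import Data.List.Membership.Propositional.Properties using (∈-map⁺; ∈-map⁻; ∈-allFin)
import Data.List.Relation.Unary.All as All
open import Data.Nat.Base
open import Data.Nat.Induction using (<-rec)
open import Data.Nat.LCM using (lcm)
open import Data.Nat.Properties
open import Data.Product using (∃; ∃₂; _×_; _,_; proj₁; proj₂)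
open import Data.Sum using (_⊎_; inj₁; inj₂)
open import Data.Vec.Functional using (Vector)
open import Function.Base using (_∘_)
open import Level using (0ℓ)
open import Relation.Binary.PropositionalEquality hiding ([_])
open import Relation.Nullary
open import Relation.Nullary.Construct.Add.Supremum
  renaming ([_] to fin; ⊤⁺ to ∞) public
open import Relation.Nullary.Decidable using (_⊎-dec_; _×-dec_; ¬?; decidable-stable)
open import Relation.Unary using (Pred; Decidable)

open Sum ℤ.+-*-semiring using (sum; sum-cong-≗)

private variable n : ℕ

Matrix : ℕ → Set
Matrix n = Vector (Vector ℤ n) n

infixl 7 _⊛_
infixr 8 _^ᴹ_
infix  4 _≈_

_⊛_ : Matrix n → Matrix n → Matrix n
(A ⊛ B) i j = sum λ k → A i k ℤ.* B k j

𝟙 : Matrix n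
𝟙 i j with i Fin.≟ j
... | yes _ = 1ℤ
... | no  _ = 0ℤ

_^ᴹ_ : Matrix n → ℕ → Matrix n
A ^ᴹ zero  = 𝟙
A ^ᴹ suc k = A ^ᴹ k ⊛ A

_≈_ : Matrix n → Matrix n → Set
A ≈ B = ∀ i j → A i j ≡ B i j

ZeroOne : Matrix n → Set
ZeroOne A = ∀ i j → A i j ≡ 0ℤ ⊎ A i j ≡ 1ℤ

ℕ∞ : Set
ℕ∞ = ℕ ⁺

Breaks : Matrix n → Pred ℕ 0ℓ
Breaks A k = 1 ≤ k × ¬ ZeroOne (A ^ᴹ (k + 1))

IsStableIndex : Matrix n → Pred ℕ∞ 0ℓ
IsStableIndex A (fin k) = Breaks A k × (∀ j → Breaks A j → k ≤ j)
IsStableIndex A ∞       = ¬ ∃ (Breaks A)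

IsStableIndex-unique : (A : Matrix n) {x y : ℕ∞} →
                       IsStableIndex A x → IsStableIndex A y → x ≡ y
IsStableIndex-unique A {fin k} {fin l} (bk , k≤) (bl , l≤) = cong fin (≤-antisym (k≤ l bl) (l≤ k bk))
IsStableIndex-unique A {fin k} {∞}     (bk , _)  ∄        = contradiction (k , bk) ∄
IsStableIndex-unique A {∞}     {fin l} ∄         (bl , _) = contradiction (l , bl) ∄
IsStableIndex-unique A {∞}     {∞}     _         _        = refl

^-cong : (A B : Matrix n) → A ≈ B → ∀ k → A ^ᴹ k ≈ B ^ᴹ k
^-cong A B A≈B zero    i j = refl
^-cong A B A≈B (suc k) i j =
  sum-cong-≗ λ l → cong₂ ℤ._*_ (^-cong A B A≈B k i l) (A≈B l j)

^-periodic : (A : Matrix n) → ∀ {a b} → A ^ᴹ a ≈ A ^ᴹ b → ∀ d → A ^ᴹ (d + a) ≈ A ^ᴹ (d + b)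
^-periodic A eq zero    i j = eq i j
^-periodic A eq (suc d) i j =
  sum-cong-≗ λ l → cong (ℤ._* A l j) (^-periodic A eq d i l)

ZeroOne-resp : {A B : Matrix n} → A ≈ B → ZeroOne A → ZeroOne B
ZeroOne-resp A≈B z i j rewrite sym (A≈B i j) = z i j

≈-sym : {A B : Matrix n} → A ≈ B → B ≈ A
≈-sym eq i j = sym (eq i j)

zeroOne? : Decidable (ZeroOne {n})
zeroOne? A = all? λ i → all? λ j → (A i j ℤ.≟ 0ℤ) ⊎-dec (A i j ℤ.≟ 1ℤ)

breaks? : (A : Matrix n) → Decidable (Breaks A)
breaks? A k = (1 ≤? k) ×-dec ¬? (zeroOne? (A ^ᴹ (k + 1)))

-- decode enumerates the 0-1 matrices of order n; there are (2^n)^n of them.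
#codes : ℕ → ℕ
#codes n = (2 ^ n) ^ n

decode : Fin (#codes n) → Matrix n
decode {n} c i j = + toℕ (finToFun {2} {n} (finToFun {2 ^ n} c i) j)

private
  digit : ℤ → Fin 2
  digit (+ zero) = zero
  digit _        = suc zero

  encode : Matrix n → Fin (#codes n)
  encode A = funToFin λ i → funToFin λ j → digit (A i j)

decode-zeroOne : (c : Fin (#codes n)) → ZeroOne (decode c)
decode-zeroOne {n} c i j with finToFun {2} {n} (finToFun {2 ^ n} c i) j
... | zero     = inj₁ refl
... | suc zero = inj₂ refl

decode-surjective : (A : Matrix n) → ZeroOne A → ∃ λ c → decode c ≈ A
decode-surjective {n} A z = encode A , λ i j →
  trans (cong (λ r → + toℕ (finToFun {2} {n} r j)) (finToFun-funToFin (λ i → funToFin λ j → digit (A i j)) i))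
 (trans (cong (λ d → + toℕ d) (finToFun-funToFin (λ j → digit (A i j)) j)) (bit (z i j)))
  where
  bit : ∀ {x} → x ≡ 0ℤ ⊎ x ≡ 1ℤ → + toℕ (digit x) ≡ x
  bit (inj₁ refl) = refl
  bit (inj₂ refl) = refl

private
  encode-injective : {A B : Matrix n} → ZeroOne A → ZeroOne B → encode A ≡ encode B → A ≈ B
  encode-injective {A = A} {B} zA zB eq i j =
    trans (sym (proj₂ (decode-surjective A zA) i j))
   (trans (cong (λ c → decode c i j) eq) (proj₂ (decode-surjective B zB) i j))

  -- Two of the powers A^2, ..., A^(#codes n + 2) agree if all are 0-1 matrices;
  -- the sequence of powers is then periodic.
  bounded : (A : Matrix n) →
            (∀ k → k < suc (#codes n) → ZeroOne (A ^ᴹ (k + 2))) →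
            ∀ k → ZeroOne (A ^ᴹ (k + 2))
  bounded {n} A low with pigeonhole (n<1+n (#codes n)) (λ k → encode (A ^ᴹ (toℕ k + 2)))
  ... | a , b , a<b , same = <-rec (λ k → ZeroOne (A ^ᴹ (k + 2))) step
    where
    repeat : A ^ᴹ (toℕ a + 2) ≈ A ^ᴹ (toℕ b + 2)
    repeat = encode-injective (low _ (toℕ<n a)) (low _ (toℕ<n b)) same

    step : ∀ k → (∀ {j} → j < k → ZeroOne (A ^ᴹ (j + 2))) → ZeroOne (A ^ᴹ (k + 2))
    step k ih with k <? suc (#codes n)
    ... | yes k<N = low k k<N
    ... | no  k≮N = subst (λ m → ZeroOne (A ^ᴹ (m + 2))) d+b≡k
          (ZeroOne-resp shifted (ih (subst (d + toℕ a <_) d+b≡k (+-monoʳ-< d a<b))))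
      where
      d = k ∸ toℕ b
      d+b≡k : d + toℕ b ≡ k
      d+b≡k = m∸n+n≡m (≤-trans (<⇒≤ (toℕ<n b)) (≮⇒≥ k≮N))
      shifted : A ^ᴹ (d + toℕ a + 2) ≈ A ^ᴹ (d + toℕ b + 2)
      shifted = subst₂ (λ x y → A ^ᴹ x ≈ A ^ᴹ y) (sym (+-assoc d _ 2)) (sym (+-assoc d _ 2))
                (^-periodic A repeat d)

  least : {P : Pred ℕ 0ℓ} → Decidable P → ∀ N →
          (∃ λ k → P k × (∀ j → P j → k ≤ j)) ⊎ (∀ j → j < N → ¬ P j)
  least P? zero = inj₂ λ _ ()
  least P? (suc N) with least P? N
  ... | inj₁ found = inj₁ found
  ... | inj₂ none with P? N
  ...   | yes p = inj₁ (N , p , λ j pj → ≮⇒≥ λ j<N → none j j<N pj)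
  ...   | no ¬p = inj₂ λ j j<1+N pj → none j (≤∧≢⇒< (s≤s⁻¹ j<1+N) λ { refl → ¬p pj }) pj

-- Opaque to keep type checking fast: IsStableIndex determines the value uniquely.
opaque
  stableIndex : (A : Matrix n) → ∃ (IsStableIndex A)
  stableIndex {n} A with least (breaks? A) (2 + #codes n)
  ... | inj₁ (k , found) = fin k , found
  ... | inj₂ none = ∞ , never
    where
    exponent : ∀ k → suc k + 1 ≡ k + 2
    exponent k = sym (+-suc k 1)

    low : ∀ k → k < suc (#codes n) → ZeroOne (A ^ᴹ (k + 2))
    low k k<N = subst (λ m → ZeroOne (A ^ᴹ m)) (exponent k)
      (decidable-stable (zeroOne? (A ^ᴹ (suc k + 1))) λ ¬z → none (suc k) (s<s k<N) (s≤s z≤n , ¬z))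

    never : ¬ ∃ (Breaks A)
    never (suc k , _ , ¬z) = ¬z (subst (λ m → ZeroOne (A ^ᴹ m)) (sym (exponent k)) (bounded A low k))

θ : Matrix n → ℕ∞
θ A = proj₁ (stableIndex A)

θ-isStableIndex : (A : Matrix n) → IsStableIndex A (θ A)
θ-isStableIndex A = proj₂ (stableIndex A)

Θ : ℕ → Pred ℕ∞ 0ℓ
Θ n x = ∃ λ (A : Matrix n) → ZeroOne A × θ A ≡ x

finitePart : ℕ∞ → ℕ
finitePart (fin k) = k
finitePart ∞       = 0

-- For n ≤ 1 there is no finite stable index and s n = 0 is a dummy value.
s : ℕ → ℕ
s n = max 0 (map (finitePart ∘ θ ∘ decode {n}) (allFin (#codes n)))

IsMaxFiniteStableIndex : ℕ → Pred ℕ 0ℓ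
IsMaxFiniteStableIndex n m = Θ n (fin m) × (∀ k → Θ n (fin k) → k ≤ m)

private
  IsStableIndex-resp : (A B : Matrix n) → A ≈ B → ∀ x → IsStableIndex A x → IsStableIndex B x
  IsStableIndex-resp A B A≈B = go
    where
    to : ∀ k → Breaks A k → Breaks B k
    to k (1≤k , ¬z) = 1≤k , ¬z ∘ ZeroOne-resp (≈-sym (^-cong A B A≈B (k + 1)))
    from : ∀ k → Breaks B k → Breaks A k
    from k (1≤k , ¬z) = 1≤k , ¬z ∘ ZeroOne-resp (^-cong A B A≈B (k + 1))
    go : ∀ x → IsStableIndex A x → IsStableIndex B x
    go (fin k) (bk , k≤) = to k bk , λ j bj → k≤ j (from j bj)
    go ∞ ∄ (k , bk) = ∄ (k , from k bk)

θ-cong : {A B : Matrix n} → A ≈ B → θ A ≡ θ B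
θ-cong {A = A} {B} A≈B = IsStableIndex-unique B
  (IsStableIndex-resp A B A≈B (θ A) (θ-isStableIndex A)) (θ-isStableIndex B)

private
  s-upper : ∀ n k → Θ n (fin k) → k ≤ s n
  s-upper n k (A , zA , θA≡k) with decode-surjective A zA
  ... | c , c≈A = subst (_≤ s n) (cong finitePart (trans (θ-cong {A = decode {n} c} c≈A) θA≡k))
    (All.lookup (xs≤max 0 (map f (allFin (#codes n)))) (∈-map⁺ f (∈-allFin c)))
    where
    f : Fin (#codes n) → ℕ
    f = finitePart ∘ θ ∘ decode {n}

  ones : Matrix n
  ones _ _ = 1ℤ

  sum-ones : ∀ n → sum {n} (λ _ → 1ℤ) ≡ + n
  sum-ones zero    = refl
  sum-ones (suc n) = cong (ℤ._+_ 1ℤ) (sum-ones n)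

  𝟙-row : ∀ n (i : Fin n) → sum (λ k → 𝟙 i k ℤ.* 1ℤ) ≡ 1ℤ
  𝟙-row (suc n) zero = cong (ℤ._+_ 1ℤ) (zeros n)
    where
    zeros : ∀ m → sum {m} (λ _ → 0ℤ) ≡ 0ℤ
    zeros zero    = refl
    zeros (suc m) = trans (ℤ.+-identityˡ _) (zeros m)
  𝟙-row (suc n) (suc i) = trans (ℤ.+-identityˡ _) (trans (sum-cong-≗ shift) (𝟙-row n i))
    where
    shift : ∀ k → 𝟙 (suc i) (suc k) ℤ.* 1ℤ ≡ 𝟙 i k ℤ.* 1ℤ
    shift k with i Fin.≟ k
    ... | yes _ = refl
    ... | no  _ = refl

  ones-breaks : ∀ n → 2 ≤ n → Breaks (ones {n}) 1
  ones-breaks (suc zero) (s≤s ())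
  ones-breaks n@(suc (suc m)) _ = s≤s z≤n , λ z → absurd (z zero zero)
    where
    row : ∀ k → (𝟙 ⊛ ones {n}) zero k ℤ.* 1ℤ ≡ 1ℤ
    row k = cong (ℤ._* 1ℤ) (𝟙-row n zero)
    square : (ones {n} ^ᴹ 2) zero zero ≡ + n
    square = trans (sum-cong-≗ {n} {λ k → (𝟙 ⊛ ones {n}) zero k ℤ.* 1ℤ} {λ _ → 1ℤ} row) (sum-ones n)
    absurd : (ones {n} ^ᴹ 2) zero zero ≡ 0ℤ ⊎ (ones {n} ^ᴹ 2) zero zero ≡ 1ℤ → ⊥
    absurd (inj₁ eq) with () ← trans (sym square) eq
    absurd (inj₂ eq) with () ← trans (sym square) eq

  1∈Θ : ∀ n → 2 ≤ n → Θ n (fin 1)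
  1∈Θ n 2≤n = ones , (λ _ _ → inj₂ refl) ,
    IsStableIndex-unique (ones {n}) {θ (ones {n})} {fin 1}
      (θ-isStableIndex (ones {n})) (ones-breaks n 2≤n , λ _ → proj₁)

s-isMaximum : ∀ n → 2 ≤ n → IsMaxFiniteStableIndex n (s n)
s-isMaximum n 2≤n = attained , s-upper n
  where
  f : Fin (#codes n) → ℕ
  f = finitePart ∘ θ ∘ decode {n}

  positive : 1 ≤ s n
  positive = s-upper n 1 (1∈Θ n 2≤n)

  finite : ∀ x → 1 ≤ finitePart x → x ≡ fin (finitePart x)
  finite (fin k) _ = refl

  attained : Θ n (fin (s n))
  attained with argmax-sel (λ m → m) 0 (map f (allFin (#codes n)))
  ... | inj₁ s≡0 = contradiction (subst (1 ≤_) s≡0 positive) λ ()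
  ... | inj₂ s∈ with ∈-map⁻ f s∈
  ...   | c , _ , s≡fc = decode {n} c , decode-zeroOne {n} c ,
          trans (finite (θ (decode {n} c)) (subst (1 ≤_) s≡fc positive)) (cong fin (sym s≡fc))

[_] : ℕ → Pred ℕ∞ 0ℓ
[ k ] x = ∃ λ m → 1 ≤ m × m ≤ k × x ≡ fin m

LCMs : ℕ → Pred ℕ∞ 0ℓ
LCMs n x = ∃₂ λ p q → 1 ≤ p × 1 ≤ q × p + q ≡ n × x ≡ fin (lcm p q)

{-# OPTIONS --safe #-}

-- θ(A) + 1 is the least length of a collision: two different walks of the same length with
-- the same ends in the digraph of A. If a cycle of length p is joined by a path with r inner
-- vertices to a disjoint cycle of length q, then going around the first cycle and along the
-- path, or along the path and around the second cycle, collide at length lcm(p, q) + r + 1,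
-- and there is nothing shorter if these are all the edges. Hence θ = lcm(p, q) + r is attained
-- whenever p + q + r ≤ n. If the second cycle is joined directly and both cycles also get an
-- edge to a common new vertex, two residues can be prescribed, and by the Chinese remainder
-- theorem all of 1, ..., lcm(p, q) are attained when p + q < n.
--
-- Conversely, extend a walk that leaves a cycle until its first repeated vertex: it either
-- returns to the cycle, giving a collision of length at most n + 1, or it closes a second cycle,
-- giving a dumbbell as above. If this dumbbell spans the graph with r = 0, a further edge gives
-- a collision of length at most n + 1 or at most pq/2 + 1. If no such walk exists, every walk
-- consists of distinct vertices, turns around one cycle, and distinct vertices again; a minimal
-- collision must not contain a common period of both walks, which bounds its length.
module Submission where

open import Algebra.Properties.Semiring.Sum as Sum using ()
open import Data.Empty using (⊥; ⊥-elim)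
open import Data.Fin.Base as Fin using (Fin; zero; suc; toℕ)
import Data.Fin.Properties as Fin
open import Data.Integer.Base as ℤ using (0ℤ; 1ℤ; ∣_∣)
import Data.Integer.Properties as ℤ
open import Data.List.Base using (List; []; _∷_; _++_; length; lookup; applyUpTo)
open import Data.List.Membership.Propositional using (_∈_)
open import Data.List.Membership.Propositional.Properties using (∈-applyUpTo⁻; ∈-++⁻; ∈-lookup)
open import Data.List.Properties using (length-++; length-applyUpTo)
import Data.List.Relation.Unary.All as All
open import Data.List.Relation.Unary.AllPairs using ([]; _∷_)
open import Data.List.Relation.Unary.Unique.Propositional using (Unique)
import Data.List.Relation.Unary.Unique.Propositional.Properties as Unique
open import Data.Nat.Base
open import Data.Nat.Coprimality using (Coprime; coprime?; coprime-Bézout; coprime⇒gcd≡1; gcd≡1⇒coprime)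
open import Data.Nat.Divisibility
open import Data.Nat.DivMod using (_%_; _/_; _mod_; m<n⇒m%n≡m; m≡m%n+[m/n]*n; m%n<n)
open import Data.Nat.GCD using (gcd; module Bézout)
open import Data.Nat.LCM using (lcm; m∣lcm[m,n]; n∣lcm[m,n]; lcm-least; gcd*lcm)
open import Data.Nat.Properties
open import Data.Nat.Tactic.RingSolver using (solve-∀)
open import Data.Product using (∃; ∃₂; _×_; _,_; proj₁; proj₂)
open import Data.Sum using (_⊎_; inj₁; inj₂; [_,_]′)
open import Function.Base using (_∘_; flip; case_of_)
open import Level using (0ℓ)
open import Relation.Binary.Core using (Rel)
import Relation.Binary.Definitions as B
open import Relation.Binary.Definitions using (tri<; tri≈; tri>)
open import Relation.Binary.PropositionalEquality hiding ([_])
open import Relation.Nullary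
open import Relation.Nullary.Decidable using (_⊎-dec_; _×-dec_; ¬?; map′; decidable-stable; toSum)
open import Relation.Unary using (_≐_; _∪_; ｛_｝)
open import Defs

open Sum ℤ.+-*-semiring using (sum; sum-cong-≗)

private variable
  V : Set
  n : ℕ

-- Walks and collisions

infixl 5 _▷_ _++ʷ_

data Walk {V : Set} (E : Rel V 0ℓ) : ℕ → Rel V 0ℓ where
  ε   : ∀ {x} → Walk E 0 x x
  _▷_ : ∀ {l x y z} → Walk E l x y → E y z → Walk E (suc l) x z

private variable
  E F : Rel V 0ℓ

walk-≡ : ∀ {k l} {x y : V} → k ≡ l → Walk E k x y → Walk E l x y
walk-≡ refl w = w

_++ʷ_ : ∀ {a b} {x y z : V} → Walk E a x y → Walk E b y z → Walk E (a + b) x z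
_++ʷ_ {a = a} w ε        = walk-≡ (sym (+-identityʳ a)) w
_++ʷ_ {a = a} w (w′ ▷ e) = walk-≡ (sym (+-suc a _)) (w ++ʷ w′ ▷ e)

walk-map : {W : Set} {F : Rel W 0ℓ} (f : V → W) → (∀ {x y} → E x y → F (f x) (f y)) →
           ∀ {l x y} → Walk E l x y → Walk F l (f x) (f y)
walk-map f hom ε       = ε
walk-map f hom (w ▷ e) = walk-map f hom w ▷ hom e

walk-flip : ∀ {l} {x y : V} → Walk E l x y → Walk (flip E) l y x
walk-flip ε       = ε
walk-flip (w ▷ e) = ε ▷ e ++ʷ walk-flip w

-- Two walks from x to y, the vertices after a steps being different.
record Collision {V : Set} (E : Rel V 0ℓ) (l : ℕ) : Set where
  constructor mkCollision
  field
    {x y u v} : V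
    {a b}     : ℕ
    a+b≡l     : a + b ≡ l
    u≢v       : u ≢ v
    x↝u       : Walk E a x u
    x↝v       : Walk E a x v
    u↝y       : Walk E b u y
    v↝y       : Walk E b v y

collision-map : {W : Set} {F : Rel W 0ℓ} (f : V → W) → (∀ {x y} → f x ≡ f y → x ≡ y) →
                (∀ {x y} → E x y → F (f x) (f y)) → ∀ {l} → Collision E l → Collision F l
collision-map f inj hom (mkCollision len u≢v p q r t) =
  mkCollision len (u≢v ∘ inj) (walk-map f hom p) (walk-map f hom q) (walk-map f hom r) (walk-map f hom t)

collision-≥2 : ∀ {l} → Collision E l → 2 ≤ l
collision-≥2 (mkCollision _    u≢v ε       ε       _       _) = contradiction refl u≢v
collision-≥2 (mkCollision _    u≢v _       _       ε       ε) = contradiction refl u≢v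
collision-≥2 (mkCollision refl _   (_▷_ {l = a} _ _) _ (_▷_ {l = b} _ _) _) =
  s≤s (≤-trans (s≤s z≤n) (m≤n+m (suc b) a))

MinCollision : Rel V 0ℓ → ℕ → Set
MinCollision E l = Collision E l × (∀ {m} → Collision E m → l ≤ m)

-- Powers of 0-1 matrices

Edge : Matrix n → Rel (Fin n) 0ℓ
Edge A i j = A i j ≡ 1ℤ

edge? : (A : Matrix n) → B.Decidable (Edge A)
edge? A i j = A i j ℤ.≟ 1ℤ

sumℕ : (Fin n → ℕ) → ℕ
sumℕ {zero}  f = 0
sumℕ {suc n} f = f zero + sumℕ (f ∘ suc)

+-sumℕ : (f : Fin n → ℕ) → sum (λ k → ℤ.+ f k) ≡ ℤ.+ sumℕ f
+-sumℕ {zero}  f = refl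
+-sumℕ {suc n} f = cong (λ z → ℤ.+ f zero ℤ.+ z) (+-sumℕ (f ∘ suc))

≤-sumℕ : (f : Fin n → ℕ) → ∀ k → f k ≤ sumℕ f
≤-sumℕ f zero    = m≤m+n _ _
≤-sumℕ f (suc k) = ≤-trans (≤-sumℕ (f ∘ suc) k) (m≤n+m _ _)

+≤-sumℕ : (f : Fin n → ℕ) → ∀ {k l} → k ≢ l → f k + f l ≤ sumℕ f
+≤-sumℕ f {zero}  {zero}  k≢l = contradiction refl k≢l
+≤-sumℕ f {zero}  {suc l} k≢l = +-monoʳ-≤ (f zero) (≤-sumℕ (f ∘ suc) l)
+≤-sumℕ f {suc k} {zero}  k≢l =
  subst (_≤ sumℕ f) (+-comm (f zero) (f (suc k))) (+-monoʳ-≤ (f zero) (≤-sumℕ (f ∘ suc) k))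
+≤-sumℕ f {suc k} {suc l} k≢l = ≤-trans (+≤-sumℕ (f ∘ suc) (k≢l ∘ cong suc)) (m≤n+m _ _)

sumℕ-≥1 : (f : Fin n → ℕ) → 1 ≤ sumℕ f → ∃ λ k → 1 ≤ f k
sumℕ-≥1 {suc n} f p with f zero in eq
... | suc m = zero , subst (1 ≤_) (sym eq) (s≤s z≤n)
... | zero  = case sumℕ-≥1 (f ∘ suc) p of λ (k , q) → suc k , q

sumℕ-≥2 : (f : Fin n → ℕ) → 2 ≤ sumℕ f →
          (∃ λ k → 2 ≤ f k) ⊎ (∃₂ λ k l → k ≢ l × 1 ≤ f k × 1 ≤ f l)
sumℕ-≥2 {suc n} f p with f zero in eq
... | suc (suc m) = inj₁ (zero , subst (2 ≤_) (sym eq) (s≤s (s≤s z≤n)))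
... | suc zero    = case sumℕ-≥1 (f ∘ suc) (s≤s⁻¹ p) of λ (k , q) →
                      inj₂ (zero , suc k , (λ ()) , subst (1 ≤_) (sym eq) (s≤s z≤n) , q)
... | zero with sumℕ-≥2 (f ∘ suc) p
...   | inj₁ (k , q) = inj₁ (suc k , q)
...   | inj₂ (k , l , k≢l , q , r) = inj₂ (suc k , suc l , k≢l ∘ Fin.suc-injective , q , r)

-- The entries of `A ^ᴹ l` once more, over the natural numbers, where a sum is bounded below by any
-- of its terms.
#walks : Matrix n → ℕ → Fin n → Fin n → ℕ
#walks A zero    i j = ∣ 𝟙 i j ∣
#walks A (suc l) i j = sumℕ λ k → #walks A l i k * ∣ A k j ∣

module _ {n : ℕ} (A : Matrix n) (A01 : ZeroOne A) where

  private
    entry : ∀ i j → A i j ≡ ℤ.+ ∣ A i j ∣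
    entry i j with A01 i j
    ... | inj₁ eq rewrite eq = refl
    ... | inj₂ eq rewrite eq = refl

    edge⁺ : ∀ {i j} → Edge A i j → ∣ A i j ∣ ≡ 1
    edge⁺ eq = cong ∣_∣ eq

    edge⁻ : ∀ i j m → 1 ≤ m * ∣ A i j ∣ → Edge A i j
    edge⁻ i j m p with A01 i j
    ... | inj₂ eq = eq
    ... | inj₁ eq rewrite eq | *-zeroʳ m = contradiction p λ ()

    summand : ∀ l i {k j} → Edge A k j → #walks A l i k * ∣ A k j ∣ ≡ #walks A l i k
    summand l i {k} {j} e = trans (cong (#walks A l i k *_) (edge⁺ e)) (*-identityʳ _)

  power≡#walks : ∀ l i j → (A ^ᴹ l) i j ≡ ℤ.+ #walks A l i j
  power≡#walks zero    i j with i Fin.≟ j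
  ... | yes _ = refl
  ... | no  _ = refl
  power≡#walks (suc l) i j = trans
    (sum-cong-≗ λ k → trans (cong₂ ℤ._*_ (power≡#walks l i k) (entry k j)) (sym (ℤ.pos-* (#walks A l i k) ∣ A k j ∣)))
    (+-sumℕ λ k → #walks A l i k * ∣ A k j ∣)

  walk⇒#walks≥1 : ∀ {l i j} → Walk (Edge A) l i j → 1 ≤ #walks A l i j
  walk⇒#walks≥1 {i = i} ε with i Fin.≟ i
  ... | yes _  = s≤s z≤n
  ... | no i≢i = contradiction refl i≢i
  walk⇒#walks≥1 {i = i} (_▷_ {l = l} {y = k} w e) =
    ≤-trans (subst (1 ≤_) (sym (summand l i e)) (walk⇒#walks≥1 w)) (≤-sumℕ _ k)

  #walks≥1⇒walk : ∀ l i j → 1 ≤ #walks A l i j → Walk (Edge A) l i j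
  #walks≥1⇒walk zero i j p with i Fin.≟ j
  ... | yes refl = ε
  ... | no  _    = contradiction p λ ()
  #walks≥1⇒walk (suc l) i j p with sumℕ-≥1 (λ k → #walks A l i k * ∣ A k j ∣) p
  ... | k , q with edge⁻ k j (#walks A l i k) q
  ...   | e = #walks≥1⇒walk l i k (subst (1 ≤_) (summand l i e) q) ▷ e

  -- Induction on the second halves. If both come through the same last vertex but one, that vertex
  -- is already counted twice; otherwise two different summands are positive. The length is `b + a`
  -- so that it unfolds with `b`.
  collision⇒#walks≥2 : ∀ {a b x y u v} → u ≢ v →
    Walk (Edge A) a x u → Walk (Edge A) a x v → Walk (Edge A) b u y → Walk (Edge A) b v y →
    2 ≤ #walks A (b + a) x y
  collision⇒#walks≥2 u≢v p q ε ε = contradiction refl u≢v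
  collision⇒#walks≥2 {a} {suc b} {x} u≢v p q (_▷_ {y = z} r e) (_▷_ {y = z′} t e′) with z Fin.≟ z′
  ... | yes refl = ≤-trans
        (subst (2 ≤_) (sym (summand (b + a) x e)) (collision⇒#walks≥2 u≢v p q r t)) (≤-sumℕ _ z)
  ... | no z≢z′ = ≤-trans (+-mono-≤ (positive r p e) (positive t q e′)) (+≤-sumℕ _ z≢z′)
    where
    positive : ∀ {w z y} → Walk (Edge A) b w z → Walk (Edge A) a x w → Edge A z y →
               1 ≤ #walks A (b + a) x z * ∣ A z y ∣
    positive w w′ e = subst (1 ≤_) (sym (summand (b + a) x e))
      (walk⇒#walks≥1 (walk-≡ (+-comm a b) (w′ ++ʷ w)))

  -- Either one vertex before `y` is already reached twice, or two different ones serve as `u` and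
  -- `v`. The equation for the end vertex lets the recursion append an edge to both walks.
  #walks≥2⇒collision : ∀ l x y → 2 ≤ #walks A l x y →
                       ∃ λ c → Collision.y {E = Edge A} {l = l} c ≡ y
  #walks≥2⇒collision zero x y p with x Fin.≟ y
  ... | yes _ = contradiction p λ { (s≤s ()) }
  ... | no  _ = contradiction p λ ()
  #walks≥2⇒collision (suc l) x y p with sumℕ-≥2 (λ k → #walks A l x k * ∣ A k y ∣) p
  ... | inj₁ (k , q) with edge⁻ k y (#walks A l x k) (≤-trans (s≤s z≤n) q)
  ...   | e with #walks≥2⇒collision l x k (subst (2 ≤_) (summand l x e) q)
  ...     | mkCollision {a = a} {b} a+b≡l u≢v p q r t , refl =
            mkCollision (trans (+-suc a b) (cong suc a+b≡l)) u≢v p q (r ▷ e) (t ▷ e) , refl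
  #walks≥2⇒collision (suc l) x y p | inj₂ (k , k′ , k≢k′ , q , q′)
    with edge⁻ k y (#walks A l x k) q | edge⁻ k′ y (#walks A l x k′) q′
  ... | e | e′ = mkCollision (+-comm l 1) k≢k′
        (#walks≥1⇒walk l x k (subst (1 ≤_) (summand l x e) q))
        (#walks≥1⇒walk l x k′ (subst (1 ≤_) (summand l x e′) q′)) (ε ▷ e) (ε ▷ e′) , refl

  ¬zeroOne⇒collision : ∀ l → ¬ ZeroOne (A ^ᴹ l) → Collision (Edge A) l
  ¬zeroOne⇒collision l ¬z with Fin.any? (λ i → Fin.any? (λ j → 2 ≤? #walks A l i j))
  ... | yes (i , j , p) = proj₁ (#walks≥2⇒collision l i j p)
  ... | no  ¬p          = contradiction (λ i j → small i j (≰⇒> λ p → ¬p (i , j , p))) ¬z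
    where
    small : ∀ i j → #walks A l i j < 2 → (A ^ᴹ l) i j ≡ 0ℤ ⊎ (A ^ᴹ l) i j ≡ 1ℤ
    small i j p with #walks A l i j in eq
    ... | 0           = inj₁ (trans (power≡#walks l i j) (cong ℤ.+_ eq))
    ... | 1           = inj₂ (trans (power≡#walks l i j) (cong ℤ.+_ eq))
    ... | suc (suc m) = contradiction p λ { (s≤s (s≤s ())) }

  collision⇒¬zeroOne : ∀ {l} → Collision (Edge A) l → ¬ ZeroOne (A ^ᴹ l)
  collision⇒¬zeroOne {l} (mkCollision {x} {y} {a = a} {b} a+b≡l u≢v p q r t) z = absurd (z x y)
    where
    many : 2 ≤ #walks A l x y
    many = subst (λ l → 2 ≤ #walks A l x y) (trans (+-comm b a) a+b≡l) (collision⇒#walks≥2 u≢v p q r t)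

    count : ∀ {m} → (A ^ᴹ l) x y ≡ ℤ.+ m → #walks A l x y ≡ m
    count eq = ℤ.+-injective (trans (sym (power≡#walks l x y)) eq)

    absurd : (A ^ᴹ l) x y ≡ 0ℤ ⊎ (A ^ᴹ l) x y ≡ 1ℤ → ⊥
    absurd (inj₁ eq) = contradiction (subst (2 ≤_) (count eq) many) λ ()
    absurd (inj₂ eq) = contradiction (subst (2 ≤_) (count eq) many) λ { (s≤s ()) }

  breaks⇒collision : ∀ {k} → Breaks A k → Collision (Edge A) (suc k)
  breaks⇒collision {k} (_ , ¬z) =
    ¬zeroOne⇒collision (suc k) (subst (λ l → ¬ ZeroOne (A ^ᴹ l)) (+-comm k 1) ¬z)

  collision⇒breaks : ∀ {k} → Collision (Edge A) (suc k) → Breaks A k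
  collision⇒breaks {k} c = s≤s⁻¹ (collision-≥2 c) ,
    subst (λ l → ¬ ZeroOne (A ^ᴹ l)) (+-comm 1 k) (collision⇒¬zeroOne c)

  minCollision⇒θ : ∀ {k} → MinCollision (Edge A) (suc k) → θ A ≡ fin k
  minCollision⇒θ {k} (c , least) = IsStableIndex-unique A (θ-isStableIndex A)
    (collision⇒breaks c , λ j b → s≤s⁻¹ (least (breaks⇒collision b)))

  θ⇒minCollision : ∀ {k} → θ A ≡ fin k → MinCollision (Edge A) (suc k)
  θ⇒minCollision {k} eq with subst (IsStableIndex A) eq (θ-isStableIndex A)
  ... | b , least = breaks⇒collision b , bound
    where
    bound : ∀ {m} → Collision (Edge A) m → suc k ≤ m
    bound {zero}  c = contradiction (collision-≥2 c) λ ()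
    bound {suc m} c = s≤s (least m (collision⇒breaks c))

  ¬collision⇒θ≡∞ : (∀ {l} → ¬ Collision (Edge A) l) → θ A ≡ ∞
  ¬collision⇒θ≡∞ ¬c = IsStableIndex-unique A (θ-isStableIndex A) λ (k , b) → ¬c (breaks⇒collision b)

-- Dumbbells and drained dumbbells

walk-iterate : ∀ {l} {x : V} → Walk E l x x → ∀ k → Walk E (k * l) x x
walk-iterate w zero    = ε
walk-iterate w (suc k) = w ++ʷ walk-iterate w k

walk-target : ∀ {l} {x y : V} → Walk E l x y → x ≢ y → ∃ λ z → E z y
walk-target ε       x≢y = contradiction refl x≢y
walk-target (w ▷ e) _   = _ , e

walk-source : ∀ {l} {x y : V} → Walk E l x y → x ≢ y → ∃ λ z → E x z
walk-source w x≢y = walk-target (walk-flip w) (x≢y ∘ sym)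

-- Graphs on ℕ keep the vertices open to arithmetic. Reduction modulo `n` carries a collision into
-- the matrix: as `u` and `v` differ, they are ends of nonempty walks, hence below `n`, and stay
-- different. Numbers below `n` that `G` does not touch become isolated vertices.
realise : ∀ {n} (G : Rel ℕ 0ℓ) → B.Decidable G → (∀ {i j} → G i j → i < n × j < n) →
          ∀ {k} → MinCollision G (suc k) → Θ n (fin k)
realise {zero} G G? bounded (mkCollision _ u≢v (p ▷ e) _ _ _ , _) with () ← proj₁ (bounded e)
realise {zero} G G? bounded (mkCollision _ u≢v ε ε _ _ , _) = contradiction refl u≢v
realise {n@(suc _)} G G? bounded {k} (c , least) = A , A01 , minCollision⇒θ A A01 (lift c , least′)
  where
  A : Matrix n
  A x y with G? (toℕ x) (toℕ y)
  ... | yes _ = 1ℤ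
  ... | no  _ = 0ℤ

  A01 : ZeroOne A
  A01 x y with G? (toℕ x) (toℕ y)
  ... | yes _ = inj₂ refl
  ... | no  _ = inj₁ refl

  edge⁻ : ∀ {x y} → Edge A x y → G (toℕ x) (toℕ y)
  edge⁻ {x} {y} e with G? (toℕ x) (toℕ y)
  ... | yes g = g
  ... | no  _ = contradiction e λ ()

  edge⁺ : ∀ {x y} → G (toℕ x) (toℕ y) → Edge A x y
  edge⁺ {x} {y} g with G? (toℕ x) (toℕ y)
  ... | yes _ = refl
  ... | no ¬g = contradiction g ¬g

  toℕ-mod : ∀ {i} → i < n → toℕ (i mod n) ≡ i
  toℕ-mod i<n = trans (Fin.toℕ-fromℕ< _) (m<n⇒m%n≡m i<n)

  hom : ∀ {i j} → G i j → Edge A (i mod n) (j mod n)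
  hom g with bounded g
  ... | i<n , j<n = edge⁺ (subst₂ G (sym (toℕ-mod i<n)) (sym (toℕ-mod j<n)) g)

  target< : ∀ {l x y v} → Walk G l x y → Walk G l x v → y ≢ v → y < n
  target< ε       ε y≢v = contradiction refl y≢v
  target< (w ▷ e) _ _   = proj₂ (bounded e)

  lift : ∀ {l} → Collision G l → Collision (Edge A) l
  lift (mkCollision {u = u} {v} a+b≡l u≢v p q r t) = mkCollision a+b≡l
    (λ eq → u≢v (trans (sym (toℕ-mod (target< p q u≢v)))
                (trans (cong toℕ eq) (toℕ-mod (target< q p (u≢v ∘ sym))))))
    (walk-map _ hom p) (walk-map _ hom q) (walk-map _ hom r) (walk-map _ hom t)

  least′ : ∀ {m} → Collision (Edge A) m → suc k ≤ m
  least′ d = least (collision-map toℕ Fin.toℕ-injective edge⁻ d)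

-- A cycle 0 → ... → p - 1 → 0, a path with r inner vertices p, ..., p + r - 1
-- and a cycle of length q through the remaining vertices.
data Dumbbell (p r q : ℕ) : Rel ℕ 0ℓ where
  step  : ∀ {i} → suc i < p + r + q → Dumbbell p r q i (suc i)
  back₁ : ∀ {i} → suc i ≡ p → Dumbbell p r q i 0
  back₂ : ∀ {i} → suc i ≡ p + r + q → Dumbbell p r q i (p + r)

dumbbell? : ∀ p r q → B.Decidable (Dumbbell p r q)
dumbbell? p r q i j = map′ from to
  (((suc i ≟ j) ×-dec (j <? p + r + q)) ⊎-dec
   (((suc i ≟ p) ×-dec (j ≟ 0)) ⊎-dec ((suc i ≟ p + r + q) ×-dec (j ≟ p + r))))
  where
  from : (suc i ≡ j × j < p + r + q) ⊎ ((suc i ≡ p × j ≡ 0) ⊎ (suc i ≡ p + r + q × j ≡ p + r)) →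
         Dumbbell p r q i j
  from (inj₁ (refl , lt))        = step lt
  from (inj₂ (inj₁ (eq , refl))) = back₁ eq
  from (inj₂ (inj₂ (eq , refl))) = back₂ eq
  to : Dumbbell p r q i j →
       (suc i ≡ j × j < p + r + q) ⊎ ((suc i ≡ p × j ≡ 0) ⊎ (suc i ≡ p + r + q × j ≡ p + r))
  to (step lt)  = inj₁ (refl , lt)
  to (back₁ eq) = inj₂ (inj₁ (eq , refl))
  to (back₂ eq) = inj₂ (inj₂ (eq , refl))

∣-difference : ∀ {d a b c} → a + b ≡ c → d ∣ c → d ∣ b → d ∣ a
∣-difference {d} {a} {b} eq d∣c d∣b = ∣m+n∣m⇒∣n (subst (d ∣_) (trans (sym eq) (+-comm a b)) d∣c) d∣b

module _ (p r q : ℕ) .{{_ : NonZero p}} .{{_ : NonZero q}} where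

  private
    m = p + r + q
    D = Dumbbell p r q

  dumbbell-< : ∀ {i j} → D i j → i < m × j < m
  dumbbell-< (step lt) = <-trans (n<1+n _) lt , lt
  dumbbell-< (back₁ refl) = ≤-trans (m≤m+n p r) (m≤m+n _ q) , ≤-trans (>-nonZero⁻¹ p) (≤-trans (m≤m+n p r) (m≤m+n _ q))
  dumbbell-< (back₂ eq) = ≤-reflexive eq , subst (_≤ m) (+-comm (p + r) 1) (+-monoʳ-≤ (p + r) (>-nonZero⁻¹ q))

  -- Every edge adds 1 to the vertex, and `back₁` and `back₂` moreover subtract `p` and `q`. So `i`
  -- and `j` count the uses of these two edges, and the equation telescopes. Turns of the first
  -- cycle require a start in it, turns of the second an end in it.
  Turns : (l x y : ℕ) → Set
  Turns l x y = ∃₂ λ i j → y + i * p + j * q ≡ x + l × (i ≡ 0 ⊎ x < p) × (j ≡ 0 ⊎ p + r ≤ y)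

  turns : ∀ {l x y} → Walk D l x y → Turns l x y
  turns {x = x} ε = 0 , 0 , trans (+-identityʳ _) refl , inj₁ refl , inj₁ refl
  turns {suc l} {x} (w ▷ e) with turns w
  turns {suc l} {x} (_▷_ {y = z} w (step _)) | i , j , eq , hi , hj =
    i , j , trans (cong suc eq) (sym (+-suc x l)) , hi , [ inj₁ , (λ le → inj₂ (m≤n⇒m≤1+n le)) ]′ hj
  turns {suc l} {x} (_▷_ {y = z} w (back₁ 1+z≡p)) | i , j , eq , hi , hj =
    suc i , j , trans (trans (cong (λ k → k + i * p + j * q) (sym 1+z≡p)) (cong suc eq)) (sym (+-suc x l)) , inj₂ (x<p hi) , inj₁ j≡0
    where
    j≡0 : j ≡ 0
    j≡0 = [ (λ j≡0 → j≡0) , (λ le → contradiction (≤-trans (m≤m+n p r) le) (<⇒≱ (≤-reflexive 1+z≡p))) ]′ hj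
    -- If `i ≡ 0`, the walk has only climbed from `x` to `z`, the last vertex of the first cycle.
    x<p : i ≡ 0 ⊎ x < p → x < p
    x<p (inj₂ lt)   = lt
    x<p (inj₁ refl) = ≤-trans (s≤s (≤-trans (m≤m+n x l) (≤-reflexive (trans (sym eq)
      (trans (cong (λ j → z + 0 + j * q) j≡0) (trans (+-identityʳ _) (+-identityʳ z))))))) (≤-reflexive 1+z≡p)
  turns {suc l} {x} (_▷_ {y = z} w (back₂ 1+z≡m)) | i , j , eq , hi , hj =
    i , suc j , trans (trans (shuffle p r q i j) (cong (λ k → k + i * p + j * q) (sym 1+z≡m)))
                      (trans (cong suc eq) (sym (+-suc x l))) , hi , inj₂ ≤-refl
    where
    shuffle : ∀ p r q i j → p + r + i * p + (q + j * q) ≡ p + r + q + i * p + j * q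
    shuffle = solve-∀

  private
    -- With equal ends and lengths, extra turns of the first cycle are balanced by turns of the
    -- second, so their total length is a common multiple of `p` and `q`. In addition the walk
    -- crosses from below `p` to at least `p + r`.
    wind : ∀ {l x y i j i′ j′} → y + i * p + j * q ≡ x + l → y + i′ * p + j′ * q ≡ x + l →
           i < i′ → (i′ ≡ 0 ⊎ x < p) → (j ≡ 0 ⊎ p + r ≤ y) → suc (lcm p q + r) ≤ l
    wind {l} {x} {y} {i} {j} {i′} {j′} eq eq′ i<i′ hx hy with m≤n⇒∃[o]m+o≡n i<i′
    ... | d , refl = case hx of λ { (inj₁ ()) ; (inj₂ x<p) → finish x<p }
      where
      turn : suc d * p + j′ * q ≡ j * q
      turn = +-cancelˡ-≡ (y + i * p) _ _ (trans (shuffle y i p d (j′ * q)) (trans eq′ (sym eq)))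
        where
        shuffle : ∀ y i p d k → y + i * p + (suc d * p + k) ≡ y + suc (i + d) * p + k
        shuffle = solve-∀

      lcm≤ : lcm p q ≤ suc d * p
      lcm≤ = ∣⇒≤ {{m*n≢0 (suc d) p}} (lcm-least (n∣m*n (suc d)) (∣-difference turn (n∣m*n j) (n∣m*n j′)))

      p+r≤y : p + r ≤ y
      p+r≤y = case hy of λ
        { (inj₂ le)   → le
        ; (inj₁ refl) → contradiction (m+n≡0⇒m≡0 (suc d * p) turn) (≢-nonZero⁻¹ _ {{m*n≢0 (suc d) p}}) }

      finish : x < p → suc (lcm p q + r) ≤ l
      finish x<p = +-cancelˡ-≤ x _ _ (begin
        x + suc (lcm p q + r)                    ≡⟨ shuffle x (lcm p q) r ⟩
        suc x + r + lcm p q                      ≤⟨ +-mono-≤ (≤-trans (+-monoˡ-≤ r x<p) p+r≤y) lcm≤ ⟩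
        y + suc d * p                            ≤⟨ m≤m+n _ (i * p + j′ * q) ⟩
        y + suc d * p + (i * p + j′ * q)         ≡⟨ shuffle₂ y d p i (j′ * q) ⟩
        y + suc (i + d) * p + j′ * q             ≡⟨ eq′ ⟩
        x + l                                    ∎)
        where
        open ≤-Reasoning
        shuffle : ∀ x c r → x + suc (c + r) ≡ suc x + r + c
        shuffle = solve-∀
        shuffle₂ : ∀ y d p i k → y + suc d * p + (i * p + k) ≡ y + suc (i + d) * p + k
        shuffle₂ = solve-∀

    -- Compares two first halves of walks with equal total turns. The one with fewer turns of the
    -- first cycle so far has some still ahead, so `u < p`, and then `u + i * p` cannot reach
    -- `suc i * p`.
    early : ∀ {u v i i′ j k} → u + i * p + j * q ≡ v + i′ * p + k → i < i′ → u < p →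
            (j ≡ 0 ⊎ p + r ≤ u) → ⊥
    early hi i<i′ u<p (inj₂ p+r≤u) = <⇒≱ u<p (≤-trans (m≤m+n p r) p+r≤u)
    early {u} {v} {i} {i′} {k = k} eq i<i′ u<p (inj₁ refl) = <-irrefl refl (begin-strict
      u + i * p + 0      ≡⟨ +-identityʳ _ ⟩
      u + i * p          <⟨ +-monoˡ-< (i * p) u<p ⟩
      suc i * p          ≤⟨ *-monoˡ-≤ p i<i′ ⟩
      i′ * p             ≤⟨ m≤n+m _ v ⟩
      v + i′ * p         ≤⟨ m≤m+n _ k ⟩
      v + i′ * p + k     ≡⟨ sym eq ⟩
      u + i * p + 0      ∎)
      where open ≤-Reasoning

    -- Here `v` lies in the second cycle, and making up for a missing turn puts `u` at least `q`
    -- further, beyond the last vertex.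
    late : ∀ {u v i j j′} → u + i * p + j * q ≡ v + i * p + j′ * q → j < j′ → u < m →
           (j′ ≡ 0 ⊎ p + r ≤ v) → ⊥
    late eq () u<m (inj₁ refl)
    late {u} {v} {i} {j} {j′} eq j<j′ u<m (inj₂ p+r≤v) = <⇒≱ u<m (+-cancelʳ-≤ (i * p + j * q) m u (begin
      m + (i * p + j * q)           ≡⟨ shuffle (p + r) q (i * p) j ⟩
      p + r + i * p + suc j * q     ≤⟨ +-mono-≤ (+-monoˡ-≤ (i * p) p+r≤v) (*-monoˡ-≤ q j<j′) ⟩
      v + i * p + j′ * q            ≡⟨ sym eq ⟩
      u + i * p + j * q             ≡⟨ +-assoc u _ _ ⟩
      u + (i * p + j * q)           ∎))
      where
      open ≤-Reasoning
      shuffle : ∀ s q k j → s + q + (k + j * q) ≡ s + k + suc j * q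
      shuffle = solve-∀

    excess : ∀ {a b c d} → a + b ≡ c + d → a < c → d < b
    excess {a} {b} {c} {d} eq a<c = ≰⇒> λ b≤d → <-irrefl eq (+-mono-<-≤ a<c b≤d)

    positive⇒ : ∀ {k l} {X : Set} → k < l → l ≡ 0 ⊎ X → X
    positive⇒ k<l (inj₁ refl) = contradiction k<l λ ()
    positive⇒ k<l (inj₂ x)    = x

    turns-++ : ∀ {a b x u y} → ((i , j , _) : Turns a x u) → ((i′ , j′ , _) : Turns b u y) →
      y + (i + i′) * p + (j + j′) * q ≡ x + (a + b) ×
      (i + i′ ≡ 0 ⊎ x < p) × (j + j′ ≡ 0 ⊎ p + r ≤ y)
    turns-++ {a} {b} {x} {u} {y} (i , j , e , hx , hu) (i′ , j′ , e′ , hu′ , hy) = total , source hx hu′ , target hy hu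
      where
      total : y + (i + i′) * p + (j + j′) * q ≡ x + (a + b)
      total = begin
        y + (i + i′) * p + (j + j′) * q          ≡⟨ shuffle y i i′ j j′ p q ⟩
        (y + i′ * p + j′ * q) + (i * p + j * q)  ≡⟨ cong (_+ (i * p + j * q)) e′ ⟩
        u + b + (i * p + j * q)                  ≡⟨ shuffle₂ u b (i * p) (j * q) ⟩
        (u + i * p + j * q) + b                  ≡⟨ cong (_+ b) e ⟩
        x + a + b                                ≡⟨ +-assoc x a b ⟩
        x + (a + b)                              ∎
        where
        open ≡-Reasoning
        shuffle : ∀ y i i′ j j′ p q → y + (i + i′) * p + (j + j′) * q ≡ (y + i′ * p + j′ * q) + (i * p + j * q)
        shuffle = solve-∀
        shuffle₂ : ∀ u b c d → u + b + (c + d) ≡ (u + c + d) + b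
        shuffle₂ = solve-∀

      source : (i ≡ 0 ⊎ x < p) → (i′ ≡ 0 ⊎ u < p) → i + i′ ≡ 0 ⊎ x < p
      source (inj₂ x<p)  _           = inj₂ x<p
      source (inj₁ refl) (inj₁ i′≡0) = inj₁ i′≡0
      source (inj₁ refl) (inj₂ u<p)  = inj₂ (≤-<-trans (≤-trans (m≤m+n x a) (≤-reflexive (trans (sym e)
        (trans (cong (λ j → u + 0 + j * q) j≡0) (trans (+-identityʳ _) (+-identityʳ u)))))) u<p)
        where
        j≡0 : j ≡ 0
        j≡0 = [ (λ j≡0 → j≡0) , (λ le → contradiction (≤-trans (m≤m+n p r) le) (<⇒≱ u<p)) ]′ hu

      target : (j′ ≡ 0 ⊎ p + r ≤ y) → (j ≡ 0 ⊎ p + r ≤ u) → j + j′ ≡ 0 ⊎ p + r ≤ y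
      target (inj₂ le)   _           = inj₂ le
      target (inj₁ refl) (inj₁ refl) = inj₁ refl
      target (inj₁ refl) (inj₂ le)   = inj₂ (≤-trans le (≤-trans (m≤m+n u b) (≤-reflexive (trans (sym e′)
        (trans (cong (λ i → y + i * p + 0) i′≡0) (trans (+-identityʳ _) (+-identityʳ y)))))))
        where
        i′≡0 : i′ ≡ 0
        i′≡0 = [ (λ i′≡0 → i′≡0) , (λ lt → contradiction (≤-trans (m≤m+n p r) le) (<⇒≱ lt)) ]′ hu′

    target< : ∀ {l x y v} → Walk D l x y → Walk D l x v → y ≢ v → y < m
    target< ε       ε y≢v = contradiction refl y≢v
    target< (w ▷ e) _ _   = proj₂ (dumbbell-< e)

  -- If the two walks turn the first cycle differently often, `wind` applies. Otherwise they also
  -- agree on the second cycle, and by `early` and `late` so do their first halves. Since turns and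
  -- length determine the position, `u` and `v` would coincide.
  dumbbell-collision-≥ : ∀ {l} → Collision D l → suc (lcm p q + r) ≤ l
  dumbbell-collision-≥ (mkCollision {x} {y} {u} {v} {a} {b} refl u≢v x↝u x↝v u↝y v↝y)
    with turns x↝u | turns x↝v | turns u↝y | turns v↝y
  ... | t₁@(i₁ , j₁ , e₁ , _ , hu) | t₂@(i₂ , j₂ , e₂ , _ , hv) | t₃@(i₃ , j₃ , _ , hu′ , _) | t₄@(i₄ , j₄ , _ , hv′ , _)
    with turns-++ t₁ t₃ | turns-++ t₂ t₄
  ... | eq , hx , hy | eq′ , hx′ , hy′ with <-cmp (i₁ + i₃) (i₂ + i₄)
  ... | tri< lt _ _ = wind {j′ = j₂ + j₄} eq eq′ lt hx′ hy
  ... | tri> _ _ gt = wind {j′ = j₁ + j₃} eq′ eq gt hx hy′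
  ... | tri≈ _ i≡ _ with *-cancelʳ-≡ (j₁ + j₃) (j₂ + j₄) q (+-cancelˡ-≡ (y + (i₂ + i₄) * p) _ _
        (trans (cong (λ i → y + i * p + (j₁ + j₃) * q) (sym i≡)) (trans eq (sym eq′))))
  ... | j≡ with <-cmp i₁ i₂
  ... | tri< lt _ _ = ⊥-elim (early {v = v} {k = j₂ * q} (trans e₁ (sym e₂)) lt (positive⇒ (excess i≡ lt) hu′) hu)
  ... | tri> _ _ gt = ⊥-elim (early {v = u} {k = j₁ * q} (trans e₂ (sym e₁)) gt (positive⇒ (excess (sym i≡) gt) hv′) hv)
  ... | tri≈ _ refl _ with <-cmp j₁ j₂
  ... | tri< lt _ _ = ⊥-elim (late {i = i₁} (trans e₁ (sym e₂)) lt (target< x↝u x↝v u≢v) hv)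
  ... | tri> _ _ gt = ⊥-elim (late {i = i₁} (trans e₂ (sym e₁)) gt (target< x↝v x↝u (u≢v ∘ sym)) hu)
  ... | tri≈ _ refl _ = contradiction
        (+-cancelʳ-≡ (i₁ * p) u v (+-cancelʳ-≡ (j₁ * q) _ _ (trans e₁ (sym e₂)))) u≢v

lcm-nonZero : ∀ p q .{{_ : NonZero p}} .{{_ : NonZero q}} → NonZero (lcm p q)
lcm-nonZero p q = ≢-nonZero λ lcm≡0 → ≢-nonZero⁻¹ (p * q) {{m*n≢0 p q}}
  (0∣⇒≡0 (subst (_∣ p * q) lcm≡0 (lcm-least {p} {q} (m∣m*n {p} q) (n∣m*n p))))

module _ (p r q : ℕ) .{{_ : NonZero p}} .{{_ : NonZero q}} where

  private
    m = p + r + q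
    D = Dumbbell p r q

  dumbbell-path : ∀ d {i} → i + d < m → Walk D d i (i + d)
  dumbbell-path zero    {i} _  = subst (Walk D 0 i) (sym (+-identityʳ i)) ε
  dumbbell-path (suc d) {i} lt =
    subst (Walk D (suc d) i) (sym (+-suc i d)) (dumbbell-path d (<-trans (n<1+n _) lt′) ▷ step lt′)
    where
    lt′ : suc (i + d) < m
    lt′ = subst (_< m) (+-suc i d) lt

  private
    p+r<m : p + r < m
    p+r<m = m<m+n (p + r) (>-nonZero⁻¹ q)

    p<m : p < m
    p<m = ≤-<-trans (m≤m+n p r) p+r<m

  dumbbell-cycle₁ : Walk D p 0 0
  dumbbell-cycle₁ = walk-≡ (suc-pred p)
    (dumbbell-path (pred p) (≤-<-trans pred[n]≤n p<m) ▷ back₁ (suc-pred p))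

  dumbbell-cycle₂ : Walk D q (p + r) (p + r)
  dumbbell-cycle₂ = walk-≡ (suc-pred q)
    (dumbbell-path (pred q) (≤-reflexive last) ▷ back₂ last)
    where
    last : suc (p + r + pred q) ≡ m
    last = trans (sym (+-suc (p + r) (pred q))) (cong (λ l → p + r + l) (suc-pred q))

  dumbbell-fork : Walk D 1 (pred p) 0 × Walk D 1 (pred p) p
  dumbbell-fork = ε ▷ back₁ (suc-pred p) ,
    subst (Walk D 1 (pred p)) (suc-pred p) (ε ▷ step (subst (_< m) (sym (suc-pred p)) p<m))

  dumbbell-collision : Collision D (suc (lcm p q + r))
  dumbbell-collision with m∣lcm[m,n] p q | n∣lcm[m,n] p q
  ... | divides zero      lcm≡0  | _ = contradiction lcm≡0 (≢-nonZero⁻¹ _ {{lcm-nonZero p q}})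
  -- Only `i` of the `suc i` laps are walked: the way from 0 to `p + r` takes the `p` steps of the
  -- remaining lap and the `r` steps of the other walk's path.
  ... | divides (suc i) lcm≡ip | divides j lcm≡jq =
    mkCollision refl (≢-sym (≢-nonZero⁻¹ p)) (proj₁ dumbbell-fork) (proj₂ dumbbell-fork)
      (walk-≡ (trans (shuffle i p r) (cong (_+ r) (sym lcm≡ip)))
        (walk-iterate dumbbell-cycle₁ i ++ʷ dumbbell-path (p + r) p+r<m))
      (walk-≡ (trans (+-comm r (j * q)) (cong (_+ r) (sym lcm≡jq)))
        (dumbbell-path r p+r<m ++ʷ walk-iterate dumbbell-cycle₂ j))
    where
    shuffle : ∀ i p r → i * p + (p + r) ≡ suc i * p + r
    shuffle = solve-∀

lcm+r∈Θ : ∀ {n} p r q → 1 ≤ p → 1 ≤ q → p + r + q ≤ n → Θ n (fin (lcm p q + r))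
lcm+r∈Θ p@(suc _) r q@(suc _) _ _ m≤n = realise (Dumbbell p r q) (dumbbell? p r q)
  (λ d → case dumbbell-< p r q d of λ (i<m , j<m) → ≤-trans i<m m≤n , ≤-trans j<m m≤n)
  (dumbbell-collision p r q , dumbbell-collision-≥ p r q)

-- Both cycles of a dumbbell with r = 0 get an edge to a new vertex p + q. The first collision
-- starts where the first cycle is left and ends in this vertex; its length is determined by
-- the residues α and β modulo p and q of the time spent on either cycle.
data Drain (p q α β : ℕ) : Rel ℕ 0ℓ where
  inner : ∀ {i j} → Dumbbell p 0 q i j → Drain p q α β i j
  exit₁ : Drain p q α β α (p + 0 + q)
  exit₂ : Drain p q α β (p + β) (p + 0 + q)

drain? : ∀ p q α β → B.Decidable (Drain p q α β)
drain? p q α β i j = map′ from to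
  (dumbbell? p 0 q i j ⊎-dec (((i ≟ α) ⊎-dec (i ≟ p + β)) ×-dec (j ≟ p + 0 + q)))
  where
  from : Dumbbell p 0 q i j ⊎ ((i ≡ α ⊎ i ≡ p + β) × j ≡ p + 0 + q) → Drain p q α β i j
  from (inj₁ d)                  = inner d
  from (inj₂ (inj₁ refl , refl)) = exit₁
  from (inj₂ (inj₂ refl , refl)) = exit₂
  to : Drain p q α β i j → Dumbbell p 0 q i j ⊎ ((i ≡ α ⊎ i ≡ p + β) × j ≡ p + 0 + q)
  to (inner d) = inj₁ d
  to exit₁     = inj₂ (inj₁ refl , refl)
  to exit₂     = inj₂ (inj₂ refl , refl)

-- `T` is the time between the fork and the exits: the residues put both walks onto exit vertices
-- then, and `T < lcm p q` makes it the first such time. The fork and the exit edge add 2 to the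
-- length.
module _ (p q : ℕ) .{{_ : NonZero p}} .{{_ : NonZero q}} (T α β i j : ℕ)
         (α<p : α < p) (β<q : β < q) (T≡α : T ≡ α + i * p) (T≡β : T ≡ β + j * q)
         (T<lcm : T < lcm p q) where

  private
    z = p + 0 + q
    G = Drain p q α β
    D = Dumbbell p 0 q

    α<z : α < z
    α<z = ≤-trans α<p (≤-trans (m≤m+n p 0) (m≤m+n _ q))

    p+β<z : p + β < z
    p+β<z = subst (λ k → p + β < k + q) (sym (+-identityʳ p)) (+-monoʳ-< p β<q)

  drain-< : ∀ {x y} → G x y → x < z × y ≤ z
  drain-< (inner d) = case dumbbell-< p 0 q d of λ (x<z , y<z) → x<z , <⇒≤ y<z
  drain-< exit₁     = α<z , ≤-refl
  drain-< exit₂     = p+β<z , ≤-refl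

  private
    inner-walk : ∀ {l x y} → Walk G l x y → y ≢ z → Walk D l x y
    inner-walk ε       _   = ε
    inner-walk (w ▷ e) y≢z with inner-walk w (<⇒≢ (proj₁ (drain-< e)))
    inner-walk (w ▷ inner d) y≢z | w′ = w′ ▷ d
    inner-walk (w ▷ exit₁)   y≢z | w′ = contradiction refl y≢z
    inner-walk (w ▷ exit₂)   y≢z | w′ = contradiction refl y≢z

    sink : ∀ {l y} → Walk G l z y → z ≡ y
    sink {y = y} w with z ≟ y
    ... | yes eq = eq
    ... | no neq = contradiction (proj₁ (drain-< (proj₂ (walk-source w neq)))) (<-irrefl refl)

    last-step : ∀ {l x y} → Walk G (suc l) x y → y ≡ z → Walk D l x α ⊎ Walk D l x (p + β)
    last-step (w ▷ inner d) refl = contradiction (proj₂ (dumbbell-< p 0 q d)) (<-irrefl refl)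
    last-step (w ▷ exit₁)   _    = inj₁ (inner-walk w (<⇒≢ α<z))
    last-step (w ▷ exit₂)   _    = inj₂ (inner-walk w (<⇒≢ p+β<z))

    -- Two simultaneous solutions differ by a multiple of both cycle lengths; a smaller one would
    -- push `T` to `lcm p q` or beyond.
    T-least : ∀ {i′ j′} → α + i′ * p ≡ β + j′ * q → T ≤ α + i′ * p
    T-least {i′} {j′} eq = ≮⇒≥ λ T′<T → case m≤n⇒∃[o]m+o≡n T′<T of λ (d , eq′) →
      let Δ : ∀ {a t k k′} s → suc (t + d) ≡ a + k * s → t ≡ a + k′ * s → s ∣ suc d
          Δ = λ {a} {t} {k} {k′} s e e′ → ∣-difference {a = suc d} {b = k′ * s} {c = k * s}
                (+-cancelˡ-≡ a _ _ (trans (shuffle a d (k′ * s)) (trans (cong (λ t → suc (t + d)) (sym e′)) e)))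
                (n∣m*n k) (n∣m*n k′)
          le : lcm p q ≤ suc d
          le = ∣⇒≤ (lcm-least (Δ {k = i} {k′ = i′} p (trans eq′ T≡α) refl)
                              (Δ {k = j} {k′ = j′} q (trans eq′ T≡β) eq))
      in <-irrefl refl (<-≤-trans T<lcm (≤-trans le (≤-trans (m≤n+m (suc d) _) (≤-reflexive (trans (+-suc _ d) eq′)))))
      where
      shuffle : ∀ a d k → a + (suc d + k) ≡ suc (a + k + d)
      shuffle = solve-∀

    -- The walk to `p + β` has left the first cycle, so the walk to `α` must turn there more often.
    -- Cancelling the common turns leaves a simultaneous solution, to which `T-least` applies.
    race : ∀ {l x} → Walk D l x α → Walk D l x (p + β) → suc T ≤ l
    race {l} {x} w₁ w₂ with turns p 0 q w₁ | turns p 0 q w₂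
    ... | i₁ , _ , e₁ , _ , inj₂ le | _ = contradiction (≤-trans (m≤m+n p 0) le) (<⇒≱ α<p)
    ... | i₁ , _ , e₁ , hx , inj₁ refl | i₂ , j₂ , e₂ , _ , _ with i₁ ≤? i₂
    ...   | yes i₁≤i₂ = contradiction (trans e₁ (sym e₂)) (<⇒≢ (begin-strict
              α + i₁ * p + 0         ≡⟨ +-identityʳ _ ⟩
              α + i₁ * p             <⟨ +-mono-<-≤ α<p (*-monoˡ-≤ p i₁≤i₂) ⟩
              p + i₂ * p             ≤⟨ +-monoˡ-≤ (i₂ * p) (m≤m+n p β) ⟩
              p + β + i₂ * p         ≤⟨ m≤m+n _ (j₂ * q) ⟩
              p + β + i₂ * p + j₂ * q ∎))
              where open ≤-Reasoning
    ...   | no i₁≰i₂ with m≤n⇒∃[o]m+o≡n (≰⇒> i₁≰i₂)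
    ...     | d , refl = case hx of λ { (inj₁ ()) ; (inj₂ x<p) → finish x<p }
      where
      meet : α + d * p ≡ β + j₂ * q
      meet = +-cancelˡ-≡ (p + i₂ * p) _ _ (trans (shuffle p i₂ α d) (trans e₁ (trans (sym e₂) (shuffle₂ p β (i₂ * p) (j₂ * q)))))
        where
        shuffle : ∀ p i α d → p + i * p + (α + d * p) ≡ α + suc (i + d) * p + 0
        shuffle = solve-∀
        shuffle₂ : ∀ p β k l → p + β + k + l ≡ p + k + (β + l)
        shuffle₂ = solve-∀

      finish : x < p → suc T ≤ l
      finish x<p = +-cancelˡ-≤ x _ _ (begin
        x + suc T                      ≡⟨ +-suc x T ⟩
        suc x + T                      ≤⟨ +-mono-≤ x<p (T-least {d} {j₂} meet) ⟩
        p + (α + d * p)                ≤⟨ m≤m+n _ (i₂ * p) ⟩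
        p + (α + d * p) + i₂ * p       ≡⟨ shuffle p α d i₂ ⟩
        α + suc (i₂ + d) * p + 0       ≡⟨ e₁ ⟩
        x + l                          ∎)
        where
        open ≤-Reasoning
        shuffle : ∀ p α d i → p + (α + d * p) + i * p ≡ α + suc (i + d) * p + 0
        shuffle = solve-∀

    dumbbell-bound : ∀ {l} → Collision D l → suc (suc T) ≤ l
    dumbbell-bound c = ≤-trans (s≤s (≤-trans T<lcm (m≤m+n _ 0))) (dumbbell-collision-≥ p 0 q c)

  -- The vertex `z` has no outgoing edge, so a collision not ending there lies in the dumbbell. If
  -- it ends in `z`, both last edges are exits: equal exits leave a collision in the dumbbell,
  -- different exits are a `race`.
  drain-collision-≥ : ∀ {l} → Collision G l → suc (suc T) ≤ l
  drain-collision-≥ (mkCollision {y = y} a+b≡l u≢v x↝u x↝v u↝y v↝y) with y ≟ z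
  drain-collision-≥ (mkCollision a+b≡l u≢v x↝u x↝v u↝y v↝y) | no y≢z = dumbbell-bound
    (mkCollision a+b≡l u≢v (inner-walk x↝u (inside u↝y)) (inner-walk x↝v (inside v↝y))
      (inner-walk u↝y y≢z) (inner-walk v↝y y≢z))
    where
    inside : ∀ {b u} → Walk G b u _ → u ≢ z
    inside w refl = y≢z (sym (sink w))
  drain-collision-≥ (mkCollision {b = zero} _ u≢v _ _ ε ε) | yes refl = contradiction refl u≢v
  drain-collision-≥ {l} (mkCollision {x} {_} {u} {v} {a} {suc b} a+b≡l u≢v x↝u x↝v u↝y v↝y) | yes refl =
    subst (suc (suc T) ≤_) (trans (sym (+-suc a b)) a+b≡l) (s≤s (arrive (last-step u↝y refl) (last-step v↝y refl)))
    where
    inside : ∀ {u} → Walk G (suc b) u z → u ≢ z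
    inside (w ▷ e) refl = <-irrefl (sym (sink w)) (proj₁ (drain-< e))

    x⇝u : Walk D a x u
    x⇝u = inner-walk x↝u (inside u↝y)
    x⇝v : Walk D a x v
    x⇝v = inner-walk x↝v (inside v↝y)

    arrive : Walk D b u α ⊎ Walk D b u (p + β) → Walk D b v α ⊎ Walk D b v (p + β) → suc T ≤ a + b
    arrive (inj₁ w) (inj₁ w′) = <⇒≤ (dumbbell-bound (mkCollision refl u≢v x⇝u x⇝v w w′))
    arrive (inj₂ w) (inj₂ w′) = <⇒≤ (dumbbell-bound (mkCollision refl u≢v x⇝u x⇝v w w′))
    arrive (inj₁ w) (inj₂ w′) = race (x⇝u ++ʷ w) (x⇝v ++ʷ w′)
    arrive (inj₂ w) (inj₁ w′) = race (x⇝v ++ʷ w′) (x⇝u ++ʷ w)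

  drain-collision : Collision G (suc (suc T))
  drain-collision = mkCollision refl (≢-sym (≢-nonZero⁻¹ p))
    (embed (proj₁ (dumbbell-fork p 0 q))) (embed (proj₂ (dumbbell-fork p 0 q)))
    (embed (walk-≡ (trans (+-comm (i * p) α) (sym T≡α))
      (walk-iterate (dumbbell-cycle₁ p 0 q) i ++ʷ dumbbell-path p 0 q α α<z)) ▷ exit₁)
    (embed (walk-≡ (trans (+-comm (j * q) β) (sym T≡β))
      (walk-iterate (subst (λ k → Walk D q k k) (+-identityʳ p) (dumbbell-cycle₂ p 0 q)) j
        ++ʷ dumbbell-path p 0 q β p+β<z)) ▷ exit₂)
    where
    embed : ∀ {l x y} → Walk D l x y → Walk G l x y
    embed = walk-map (λ x → x) inner

-- The exits are placed at the residues of `T = t - 1`; a first collision of length `T + 2` means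
-- stable index `t`.
1≤t≤lcm⇒t∈Θ : ∀ {n} p q t → 1 ≤ p → 1 ≤ q → suc (p + q) ≤ n → 1 ≤ t → t ≤ lcm p q → Θ n (fin t)
1≤t≤lcm⇒t∈Θ {n} p@(suc _) q@(suc _) (suc T) _ _ m<n _ T<lcm = realise (Drain p q (T % p) (T % q)) (drain? p q _ _)
  (λ d → case drain-< p q T (T % p) (T % q) (T / p) (T / q) (m%n<n T p) (m%n<n T q)
                (m≡m%n+[m/n]*n T p) (m≡m%n+[m/n]*n T q) T<lcm d of λ
           (x<z , y≤z) → ≤-trans x<z (<⇒≤ z<n) , ≤-<-trans y≤z z<n)
  (drain-collision p q T _ _ (T / p) (T / q) (m%n<n T p) (m%n<n T q)
                (m≡m%n+[m/n]*n T p) (m≡m%n+[m/n]*n T q) T<lcm ,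
   drain-collision-≥ p q T _ _ (T / p) (T / q) (m%n<n T p) (m%n<n T q)
                (m≡m%n+[m/n]*n T p) (m≡m%n+[m/n]*n T q) T<lcm)
  where
  z<n : p + 0 + q < n
  z<n = subst (λ k → k + q < n) (sym (+-identityʳ p)) m<n

-- Walks leaving a cycle

Steps : Rel V 0ℓ → (ℕ → V) → ℕ → Set
Steps E g T = ∀ t → t < T → E (g t) (g (suc t))

InjectiveBelow : (ℕ → V) → ℕ → Set
InjectiveBelow g T = ∀ i j → i < j → j < T → g i ≢ g j

steps-walk : (g : ℕ → V) → ∀ {T} → Steps E g T → ∀ d {i} → i + d ≤ T → Walk E d (g i) (g (i + d))
steps-walk {E = E} g steps zero    {i} _  = subst (λ k → Walk E 0 (g i) (g k)) (sym (+-identityʳ i)) ε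
steps-walk {E = E} g {T} steps (suc d) {i} le = subst (λ k → Walk E (suc d) (g i) (g k)) (sym (+-suc i d))
  (steps-walk g steps d (≤-trans (n≤1+n _) le′) ▷ steps _ le′)
  where
  le′ : suc (i + d) ≤ T
  le′ = subst (_≤ T) (+-suc i d) le

steps-walk′ : (g : ℕ → V) → ∀ {T} → Steps E g T → ∀ {i j} → i ≤ j → j ≤ T → Walk E (j ∸ i) (g i) (g j)
steps-walk′ {E = E} g {T} steps {i} {j} i≤j j≤T = subst (λ k → Walk E (j ∸ i) (g i) (g k)) (m+[n∸m]≡n i≤j)
  (steps-walk g steps (j ∸ i) (subst (_≤ T) (sym (m+[n∸m]≡n i≤j)) j≤T))

-- After its end a walk rests at its last vertex, which makes it a sequence on all of ℕ.
visit : ∀ {l} {x y : V} → Walk E l x y → ℕ → V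
visit (ε {x})                t = x
visit (_▷_ {l = l} {z = z} w e) t with t ≤? l
... | yes _ = visit w t
... | no  _ = z

visit-last : ∀ {l} {x y : V} (w : Walk E l x y) → visit w l ≡ y
visit-last ε = refl
visit-last (_▷_ {l = l} w e) with suc l ≤? l
... | yes lt = contradiction lt (<-irrefl refl)
... | no  _  = refl

visit-first : ∀ {l} {x y : V} (w : Walk E l x y) → visit w 0 ≡ x
visit-first ε = refl
visit-first (_▷_ {l = l} w e) with 0 ≤? l
... | yes _ = visit-first w
... | no ≰0 = contradiction z≤n ≰0

visit-steps : ∀ {l} {x y : V} (w : Walk E l x y) → Steps E (visit w) l
visit-steps {E = E} (_▷_ {l = l} {y = y} {z = z} w e) t (s≤s t≤l) with t ≤? l | suc t ≤? l
... | yes _   | yes lt = visit-steps w t lt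
... | yes _   | no ≰l  = subst (λ v → E v z)
      (sym (trans (cong (visit w) (≤-antisym t≤l (s≤s⁻¹ (≰⇒> ≰l)))) (visit-last w))) e
... | no ≰l   | _      = contradiction t≤l ≰l

unique⇒lookup-injective : {xs : List V} → Unique xs → ∀ i j → lookup xs i ≡ lookup xs j → i ≡ j
unique⇒lookup-injective (_   ∷ _)   zero    zero    _  = refl
unique⇒lookup-injective (x∉  ∷ _)   zero    (suc j) eq = contradiction eq (All.lookup x∉ (∈-lookup j))
unique⇒lookup-injective (x∉  ∷ _)   (suc i) zero    eq = contradiction (sym eq) (All.lookup x∉ (∈-lookup i))
unique⇒lookup-injective (_   ∷ xs!) (suc i) (suc j) eq = cong suc (unique⇒lookup-injective xs! i j eq)

unique-length≤ : {xs : List (Fin n)} → Unique xs → length xs ≤ n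
unique-length≤ {xs = xs} xs! = Fin.injective⇒≤ {f = lookup xs} λ {i} {j} → unique⇒lookup-injective xs! i j

injectiveBelow-≤ : (g : ℕ → Fin n) → ∀ {T} → InjectiveBelow g T → T ≤ n
injectiveBelow-≤ {n} g {T} inj =
  subst (_≤ n) (length-applyUpTo g T) (unique-length≤ (Unique.applyUpTo⁺₁ g T λ {i} {j} → inj i j))

FirstRepeat : (ℕ → V) → ℕ → Set
FirstRepeat g T = ∃ λ j → j < T × g j ≡ g T × InjectiveBelow g T

first-repeat : (g : ℕ → Fin n) → ∃ λ T → T ≤ n × FirstRepeat g T
first-repeat {n} g = [ (λ inj → contradiction (injectiveBelow-≤ g inj) (<-irrefl refl)) ,
    (λ (T , T<1+n , rep) → T , s≤s⁻¹ T<1+n , rep) ]′ (search (suc n))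
  where
  search : ∀ N → InjectiveBelow g N ⊎ ∃ λ T → T < N × FirstRepeat g T
  search zero = inj₁ λ _ _ _ ()
  search (suc N) with search N
  ... | inj₂ (T , T<N , rep) = inj₂ (T , m≤n⇒m≤1+n T<N , rep)
  ... | inj₁ inj with anyUpTo? (λ j → g j Fin.≟ g N) N
  ...   | yes (j , j<N , eq) = inj₂ (N , ≤-refl , j , j<N , eq , inj)
  ...   | no  ¬rep = inj₁ inj′
    where
    inj′ : InjectiveBelow g (suc N)
    inj′ i j i<j (s≤s j≤N) eq with m≤n⇒m<n∨m≡n j≤N
    ... | inj₁ j<N  = inj i j i<j j<N eq
    ... | inj₂ refl = ¬rep (i , i<j , eq)

-- `exact` is a spanning dumbbell with `r = 0` and no further edge; `half` covers a second bridge or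
-- cycle lengths that are not coprime; `long` is a bound by a dumbbell with a vertex outside its
-- cycles. For `n ≥ 7` every outcome but `exact` stays within `s (n ∸ 1) + 1`.
data Outcome (n k : ℕ) : Set where
  short : k ≤ n → Outcome n k
  exact : ∀ p q → 1 ≤ p → 1 ≤ q → p + q ≡ n → k ≡ lcm p q → Outcome n k
  half  : ∀ p q → 1 ≤ p → 1 ≤ q → p + q ≡ n → k + k ≤ p * q → Outcome n k
  long  : ∀ p r q → 1 ≤ p → 1 ≤ r → 1 ≤ q → p + r + q ≡ n → k ≤ lcm p q + r → Outcome n k

-- The cycle has length suc p′.
Ring : Rel V 0ℓ → (ℕ → V) → ℕ → Set
Ring E c p′ = Steps E c p′ × E (c p′) (c 0)

module _ {V : Set} {E : Rel V 0ℓ} (c : ℕ → V) (p′ : ℕ) (ring : Ring E c p′) where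

  ring-next : ∀ {i} → i ≤ p′ → ∃ λ s → s ≤ p′ × (suc i ≡ s ⊎ (i ≡ p′ × s ≡ 0)) ×
              E (c i) (c s) × Walk E p′ (c s) (c i)
  ring-next {i} i≤p′ with m≤n⇒m<n∨m≡n i≤p′
  ... | inj₂ refl = 0 , z≤n , inj₂ (refl , refl) , proj₂ ring , steps-walk c (proj₁ ring) p′ ≤-refl
  ... | inj₁ i<p′ = suc i , i<p′ , inj₁ refl , proj₁ ring i i<p′ ,
    walk-≡ (trans (+-assoc (p′ ∸ suc i) 1 i) (m∸n+n≡m i<p′))
      (steps-walk′ c (proj₁ ring) i<p′ ≤-refl ++ʷ (ε ▷ proj₂ ring) ++ʷ steps-walk′ c (proj₁ ring) z≤n i≤p′)

  ring-loop : ∀ {i} → i ≤ p′ → Walk E (suc p′) (c i) (c i)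
  ring-loop i≤p′ with ring-next i≤p′
  ... | s , _ , _ , e , w = ε ▷ e ++ʷ w

  -- One walk takes the ring edge, goes round to `c i` and then takes the chord; the other takes the
  -- chord first and then makes a full lap.
  chord-collision : ∀ {i j} → i ≤ p′ → j ≤ p′ → E (c i) (c j) → InjectiveBelow c (suc p′) →
    suc i ≢ j → ¬ (i ≡ p′ × j ≡ 0) → Collision E (suc (suc p′))
  chord-collision {i} {j} i≤p′ j≤p′ e inj j≢1+i j≢0 with ring-next i≤p′
  ... | s , s≤p′ , next , e′ , w = mkCollision refl distinct (ε ▷ e′) (ε ▷ e) (w ▷ e) (ring-loop j≤p′)
    where
    distinct : c s ≢ c j
    distinct eq with <-cmp s j
    ... | tri< lt _ _   = inj s j lt (s≤s j≤p′) eq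
    ... | tri> _ _ gt   = inj j s gt (s≤s s≤p′) (sym eq)
    ... | tri≈ _ refl _ = [ j≢1+i , j≢0 ]′ next

chinese-remainder : ∀ p q .{{_ : NonZero p}} .{{_ : NonZero q}} → Coprime p q → ∀ a b →
                    ∃₂ λ x y → a + x * p ≡ b + y * q
chinese-remainder (suc p) (suc q) coprime a b with coprime-Bézout coprime
-- `k` is `b - a` modulo `suc q`, with `a * q` standing for `-a`; in the other case it is `a - b`
-- modulo `suc p`.
... | Bézout.+- x y eq = k * x , a + k * y , (begin
      a + k * x * suc p            ≡⟨ cong (a +_) (trans (*-assoc k x _) (cong (k *_) (sym eq))) ⟩
      a + k * suc (y * suc q)      ≡⟨ shuffle a b q y ⟩
      b + (a + k * y) * suc q      ∎)
      where
      open ≡-Reasoning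
      k = b + a * q
      shuffle : ∀ a b q y → a + (b + a * q) * suc (y * suc q) ≡ b + (a + (b + a * q) * y) * suc q
      shuffle = solve-∀
... | Bézout.-+ x y eq = b + k * x , k * y , (begin
      a + (b + k * x) * suc p      ≡⟨ shuffle a b p x ⟩
      b + k * suc (x * suc p)      ≡⟨ cong (b +_) (trans (cong (k *_) eq) (sym (*-assoc k y _))) ⟩
      b + k * y * suc q            ∎)
      where
      open ≡-Reasoning
      k = a + b * p
      shuffle : ∀ a b p x → a + (b + (a + b * p) * x) * suc p ≡ b + (a + b * p) * suc (x * suc p)
      shuffle = solve-∀

opaque
  -- The two remainders determine t and the complementary t′ = p q - t, both as numbers of
  -- steps from position 0 of a cycle (lengths p, q) and back to it.
  complementary-times : ∀ p q → Coprime (suc p) (suc q) → ∀ {i β} → i ≤ p → β ≤ q → ¬ (i ≡ p × β ≡ 0) →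
    ∃₂ λ x y → ∃₂ λ x′ y′ →
      suc i + x * suc p ≡ β + y * suc q ×
      (p ∸ i) + x′ * suc p ≡ (suc q ∸ β) + y′ * suc q ×
      (suc i + x * suc p) + ((p ∸ i) + x′ * suc p) ≡ suc p * suc q
  complementary-times p q coprime {i} {β} i≤p β≤q ≢0 with chinese-remainder (suc p) (suc q) coprime (suc i) β
  ... | X , Y , eq = x , y , q ∸ x , p ∸ y , time , time′ , total
    where
    x c t N : ℕ
    -- Reducing modulo the other cycle length brings `t` between 1 and `N`; `y` is lowered
    -- accordingly.
    x = X % suc q
    c = X / suc q * suc p
    t = suc i + x * suc p
    N = suc p * suc q

    x≤q : x ≤ q
    x≤q = s≤s⁻¹ (m%n<n X (suc q))

    eq′ : t + c * suc q ≡ β + Y * suc q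
    eq′ = trans (trans (shuffle (suc i) x (X / suc q) p q) (cong (λ X → suc i + X * suc p) (sym (m≡m%n+[m/n]*n X (suc q))))) eq
      where
      shuffle : ∀ i x z p q → i + x * suc p + z * suc p * suc q ≡ i + (x + z * suc q) * suc p
      shuffle = solve-∀

    c≤Y : c ≤ Y
    c≤Y = ≮⇒≥ λ Y<c → case m≤n⇒∃[o]m+o≡n Y<c of λ (d , Y+d) →
      let β-big : t + suc d * suc q ≡ β
          β-big = +-cancelʳ-≡ (Y * suc q) _ _ (trans (shuffle t d Y (suc q)) (trans (cong (λ c → t + c * suc q) Y+d) eq′))
      in <⇒≱ (s≤s β≤q) (≤-trans (≤-trans (m≤m+n (suc q) (d * suc q)) (m≤n+m _ t)) (≤-reflexive β-big))
      where
      shuffle : ∀ t d Y q → t + suc d * q + Y * q ≡ t + suc (Y + d) * q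
      shuffle = solve-∀

    y : ℕ
    y = Y ∸ c

    time : t ≡ β + y * suc q
    time = +-cancelʳ-≡ (c * suc q) _ _ (trans eq′ (trans (cong (λ Y → β + Y * suc q) (sym (m∸n+n≡m c≤Y))) (shuffle β y c (suc q))))
      where
      shuffle : ∀ β y c q → β + (y + c) * q ≡ β + y * q + c * q
      shuffle = solve-∀

    total : t + ((p ∸ i) + (q ∸ x) * suc p) ≡ N
    total = begin
      suc i + x * suc p + ((p ∸ i) + (q ∸ x) * suc p)   ≡⟨ shuffle i x (p ∸ i) (q ∸ x) p ⟩
      suc (i + (p ∸ i)) + (x + (q ∸ x)) * suc p         ≡⟨ cong₂ (λ a b → suc a + b * suc p) (m+[n∸m]≡n i≤p) (m+[n∸m]≡n x≤q) ⟩
      suc p + q * suc p                                 ≡⟨ *-comm (suc q) (suc p) ⟩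
      N                                                 ∎
      where
      open ≡-Reasoning
      shuffle : ∀ i x i′ x′ p → suc i + x * suc p + (i′ + x′ * suc p) ≡ suc (i + i′) + (x + x′) * suc p
      shuffle = solve-∀

    -- Otherwise `t` is at least `N + β`, while `x ≤ q` bounds it by `suc i + q * suc p`. This
    -- leaves only `i ≡ p` and `β ≡ 0`, the first bridge itself.
    y≤p : y ≤ p
    y≤p = ≮⇒≥ λ p<y →
      let N≤t : N + β ≤ t
          N≤t = ≤-trans (≤-reflexive (+-comm N β)) (≤-trans (+-monoʳ-≤ β (*-monoˡ-≤ (suc q) p<y)) (≤-reflexive (sym time)))
          t≤N : t ≤ suc i + q * suc p
          t≤N = +-monoʳ-≤ (suc i) (*-monoˡ-≤ (suc p) x≤q)
          bound : suc p + β ≤ suc i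
          bound = +-cancelʳ-≤ (q * suc p) _ _ (≤-trans (≤-reflexive (shuffle p q β)) (≤-trans N≤t t≤N))
          i≡p : i ≡ p
          i≡p = ≤-antisym i≤p (s≤s⁻¹ (≤-trans (m≤m+n (suc p) β) bound))
      in ≢0 (i≡p , n≤0⇒n≡0 (+-cancelˡ-≤ (suc p) β 0 (≤-trans bound (≤-trans (s≤s i≤p) (≤-reflexive (sym (+-identityʳ (suc p))))))))
      where
      shuffle : ∀ p q β → suc p + β + q * suc p ≡ suc p * suc q + β
      shuffle = solve-∀

    time′ : (p ∸ i) + (q ∸ x) * suc p ≡ (suc q ∸ β) + (p ∸ y) * suc q
    time′ = +-cancelˡ-≡ t _ _ (begin
      t + ((p ∸ i) + (q ∸ x) * suc p)                            ≡⟨ total ⟩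
      suc q + p * suc q                                          ≡⟨ sym (cong₂ (λ a b → a + b * suc q) (m+[n∸m]≡n (m≤n⇒m≤1+n β≤q)) (m+[n∸m]≡n y≤p)) ⟩
      (β + (suc q ∸ β)) + (y + (p ∸ y)) * suc q                  ≡⟨ shuffle β (suc q ∸ β) y (p ∸ y) (suc q) ⟩
      (β + y * suc q) + ((suc q ∸ β) + (p ∸ y) * suc q)          ≡⟨ cong (_+ ((suc q ∸ β) + (p ∸ y) * suc q)) (sym time) ⟩
      t + ((suc q ∸ β) + (p ∸ y) * suc q)                        ∎)
      where
      open ≡-Reasoning
      shuffle : ∀ β β′ y y′ q → (β + β′) + (y + y′) * q ≡ (β + y * q) + (β′ + y′ * q)
      shuffle = solve-∀

∸-suc : ∀ {i p} → i ≤ p → suc p ∸ i ≡ suc (p ∸ i)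
∸-suc = +-∸-assoc 1

module _ {V : Set} {E : Rel V 0ℓ} {k : ℕ} (least : ∀ {m} → Collision E m → suc k ≤ m)
         (c : ℕ → V) (p : ℕ) (ring : Ring E c p) (d : ℕ → V) (q : ℕ) (ring′ : Ring E d q)
         (disjoint : ∀ {i j} → i ≤ p → j ≤ q → c i ≢ d j) (bridge : E (c p) (d 0)) where

  -- Two bridges give two collisions: one walk crosses by the first bridge and waits in the second
  -- cycle for the walk crossing by the other, or the reverse. After the fork they take the
  -- complementary times, whose sum is the product of the cycle lengths, and `k` is at most either
  -- time.
  second-bridge : ∀ {i β} → i ≤ p → β ≤ q → E (c i) (d β) → ¬ (i ≡ p × β ≡ 0) → Coprime (suc p) (suc q) →
                  k + k ≤ suc p * suc q
  second-bridge {i} {β} i≤p β≤q e ≢0 coprime with complementary-times p q coprime i≤p β≤q ≢0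
  ... | x , y , x′ , y′ , time , time′ , total =
    ≤-trans (+-mono-≤ (s≤s⁻¹ (least out)) (s≤s⁻¹ (least back))) (≤-reflexive total)
    where
    out : Collision E (suc (suc i + x * suc p))
    out = mkCollision refl (disjoint z≤n z≤n) (ε ▷ proj₂ ring) (ε ▷ bridge)
      (walk-≡ (cong suc (+-comm (x * suc p) i))
        (walk-iterate (ring-loop c p ring z≤n) x ++ʷ steps-walk′ c (proj₁ ring) z≤n i≤p ▷ e))
      (walk-≡ (trans (+-comm (y * suc q) β) (sym time))
        (walk-iterate (ring-loop d q ring′ z≤n) y ++ʷ steps-walk′ d (proj₁ ring′) z≤n β≤q))

    home : Walk E ((p ∸ i) + x′ * suc p) (d β) (d 0)
    home = walk-≡ (trans (cong (_+ y′ * suc q) (sym (∸-suc β≤q))) (sym time′))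
      ((steps-walk′ d (proj₁ ring′) β≤q ≤-refl ▷ proj₂ ring′) ++ʷ walk-iterate (ring-loop d q ring′ z≤n) y′)

    back : Collision E (suc ((p ∸ i) + x′ * suc p))
    back with m≤n⇒m<n∨m≡n i≤p
    ... | inj₁ i<p = mkCollision refl (disjoint i<p β≤q) (ε ▷ proj₁ ring i i<p) (ε ▷ e)
          (walk-≡ (cong (_+ x′ * suc p) (sym (∸-suc i<p)))
            (steps-walk′ c (proj₁ ring) i<p ≤-refl ++ʷ walk-iterate (ring-loop c p ring ≤-refl) x′ ▷ bridge)) home
    ... | inj₂ refl = mkCollision refl (disjoint z≤n β≤q) (ε ▷ proj₂ ring) (ε ▷ e) (turn x′ refl) home
      where
      -- From `c 0` the way to and over the bridge uses up one of the `x′` laps. There is one, since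
      -- by `time′` the time is positive.
      turn : ∀ z → z ≡ x′ → Walk E ((p ∸ p) + x′ * suc p) (c 0) (d 0)
      turn zero refl = contradiction
        (trans (sym (trans (+-identityʳ (p ∸ p)) (n∸n≡0 p))) (trans time′ (cong (_+ y′ * suc q) (∸-suc β≤q)))) λ ()
      turn (suc z) refl = walk-≡ (cong (_+ suc z * suc p) (sym (n∸n≡0 p)))
        (steps-walk c (proj₁ ring) p ≤-refl ++ʷ walk-iterate (ring-loop c p ring ≤-refl) z ▷ bridge)

-- The gcd is at least 2 and `gcd * lcm` is the product, so such a dumbbell already falls under
-- `half`.
¬coprime⇒2lcm≤* : ∀ p q .{{_ : NonZero p}} .{{_ : NonZero q}} → ¬ Coprime p q → lcm p q + lcm p q ≤ p * q
¬coprime⇒2lcm≤* p q ¬coprime with gcd p q in g≡ | gcd*lcm p q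
... | 0           | eq = contradiction (sym eq) (≢-nonZero⁻¹ (p * q) {{m*n≢0 p q}})
... | 1           | _  = ⊥-elim (¬coprime (gcd≡1⇒coprime g≡))
... | suc (suc g) | eq = ≤-trans (+-monoʳ-≤ (lcm p q) (m≤m+n (lcm p q) (g * lcm p q))) (≤-reflexive eq)

module _ {n k : ℕ} {E : Rel (Fin n) 0ℓ} (E? : B.Decidable E)
         (collision : Collision E (suc k)) (least : ∀ {m} → Collision E m → suc k ≤ m) where

  injective⇒surjective : (g : ℕ → Fin n) → InjectiveBelow g n → ∀ v → ∃ λ i → i < n × g i ≡ v
  injective⇒surjective g inj v with anyUpTo? (λ i → g i Fin.≟ v) n
  ... | yes found = found
  ... | no  ¬found = contradiction (injectiveBelow-≤ h h-inj) (<-irrefl refl)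
    where
    h : ℕ → Fin n
    h zero    = v
    h (suc i) = g i
    h-inj : InjectiveBelow h (suc n)
    h-inj zero    (suc j) _         (s≤s j<n) eq = ¬found (j , j<n , sym eq)
    h-inj (suc i) (suc j) (s≤s i<j) (s≤s j<n) eq = inj i j i<j j<n eq

  -- A walk g whose first suc p vertices form a cycle that g leaves at time suc p.
  module _ (g : ℕ → Fin n) (p : ℕ) (p<n : p < n) (steps : Steps E g n) (back : E (g p) (g 0))
           (leaves : g (suc p) ≢ g 0) (simple : InjectiveBelow g (suc p)) where

    private
      ring : Ring E g p
      ring = (λ t t<p → steps t (<-trans t<p p<n)) , back

      -- From `g p`, one walk closes the ring and then goes round it and along the ear; the other
      -- goes along the ear at once and makes its lap afterwards.
      ear : ∀ {a j} → j ≤ p → Walk E a (g (suc p)) (g j) → Walk E (a + suc p) (g 0) (g j) → k ≤ a + suc p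
      ear j≤p w w′ = s≤s⁻¹ (least (mkCollision refl (≢-sym leaves) (ε ▷ back) (ε ▷ steps p p<n) w′
        (w ++ʷ ring-loop g p ring j≤p)))

      tail : ∀ i d → i + d ≤ n → Steps E (λ t → g (i + t)) d
      tail i d i+d≤n t t<d = subst (λ j → E (g (i + t)) (g j)) (sym (+-suc i t))
        (steps (i + t) (<-≤-trans (+-monoʳ-< i t<d) i+d≤n))

      dumbbell : ∀ r q → suc p + r + q < n → E (g (suc p + r + q)) (g (suc p + r)) →
                 k ≤ lcm (suc p) (suc q) + r
      dumbbell r q in-range close with m∣lcm[m,n] (suc p) (suc q) | n∣lcm[m,n] (suc p) (suc q)
      ... | divides zero    lcm≡0  | _ = contradiction lcm≡0 (≢-nonZero⁻¹ _ {{lcm-nonZero (suc p) (suc q)}})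
      ... | divides (suc i) lcm≡ip | divides j lcm≡jq =
        s≤s⁻¹ (least (mkCollision refl (≢-sym leaves) (ε ▷ back) (ε ▷ steps p p<n)
          (walk-≡ (trans (shuffle i p r) (cong (_+ r) (sym lcm≡ip)))
            (walk-iterate (ring-loop g p ring z≤n) i ++ʷ steps-walk g steps (suc p + r) (<⇒≤ end)))
          (walk-≡ (trans (+-comm r _) (cong (_+ r) (sym lcm≡jq)))
            (steps-walk g steps r (<⇒≤ end) ++ʷ
             walk-iterate (steps-walk g steps q (<⇒≤ in-range) ▷ close) j))))
        where
        end : suc p + r < n
        end = ≤-<-trans (m≤m+n _ q) in-range
        shuffle : ∀ i p r → i * suc p + (suc p + r) ≡ suc i * suc p + r
        shuffle = solve-∀

      -- Without a further edge the graph embeds into a dumbbell, whose lower bound applies. A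
      -- further edge within one cycle is a chord, one from the second cycle to the first closes an
      -- ear, and one from the first to the second is a second bridge.
      spanning : ∀ q → suc p + suc q ≡ n → InjectiveBelow g n → E (g (suc p + q)) (g (suc p)) →
                 k ≤ lcm (suc p) (suc q) → Outcome n k
      spanning q size inj close k≤lcm with
        anyUpTo? (λ i → anyUpTo? (λ j → E? (g i) (g j) ×-dec ¬? (dumbbell? (suc p) 0 (suc q) i j)) n) n
      ... | no ¬extra = exact (suc p) (suc q) (s≤s z≤n) (s≤s z≤n) size (≤-antisym k≤lcm
              (subst (_≤ k) (+-identityʳ _) (s≤s⁻¹ (dumbbell-collision-≥ (suc p) 0 (suc q) (collision-map label label-inj hom collision)))))
        where
        label : Fin n → ℕ
        label v = proj₁ (injective⇒surjective g inj v)
        label< : ∀ v → label v < n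
        label< v = proj₁ (proj₂ (injective⇒surjective g inj v))
        g-label : ∀ v → g (label v) ≡ v
        g-label v = proj₂ (proj₂ (injective⇒surjective g inj v))
        label-inj : ∀ {x y} → label x ≡ label y → x ≡ y
        label-inj {x} {y} eq = trans (sym (g-label x)) (trans (cong g eq) (g-label y))
        hom : ∀ {x y} → E x y → Dumbbell (suc p) 0 (suc q) (label x) (label y)
        hom {x} {y} e = decidable-stable (dumbbell? (suc p) 0 (suc q) (label x) (label y)) λ ¬d →
          ¬extra (label x , label< x , label y , label< y , subst₂ E (sym (g-label x)) (sym (g-label y)) e , ¬d)
      ... | yes (i , i<n , j , j<n , e , ¬d) = cases (i ≤? p) (j ≤? p)
        where
        d : ℕ → Fin n
        d t = g (suc p + t)

        m≡n : suc p + 0 + suc q ≡ n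
        m≡n = trans (cong (_+ suc q) (+-identityʳ (suc p))) size

        in-range : ∀ {t} → t ≤ q → suc p + t < n
        in-range t≤q = subst (_ <_) size (+-monoʳ-< (suc p) (s≤s t≤q))

        d-start : d 0 ≡ g (suc p)
        d-start = cong g (+-identityʳ (suc p))

        ring′ : Ring E d q
        ring′ = tail (suc p) q (<⇒≤ (in-range ≤-refl)) , subst (E (d q)) (sym d-start) close

        d-inj : InjectiveBelow d (suc q)
        d-inj i j i<j j≤q = inj (suc p + i) (suc p + j) (+-monoʳ-< (suc p) i<j) (in-range (s≤s⁻¹ j≤q))

        position : ∀ {i} → i < n → i ≰ p → ∃ λ i′ → suc p + i′ ≡ i × i′ ≤ q
        position i<n i≰p with m≤n⇒∃[o]m+o≡n (≰⇒> i≰p)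
        ... | i′ , refl = i′ , refl , s≤s⁻¹ (+-cancelˡ-< (suc p) i′ (suc q) (subst (suc p + i′ <_) (sym size) i<n))

        step-≢ : suc i ≢ j
        step-≢ refl = ¬d (step (subst (j <_) (sym m≡n) j<n))

        cases : Dec (i ≤ p) → Dec (j ≤ p) → Outcome n k
        cases (yes i≤p) (yes j≤p) = short (≤-trans
          (s≤s⁻¹ (least (chord-collision g p ring i≤p j≤p e simple step-≢ λ { (refl , refl) → ¬d (back₁ refl) }))) p<n)
        cases (no i≰p) (no j≰p) with position i<n i≰p | position j<n j≰p
        ... | i′ , refl , i′≤q | j′ , refl , j′≤q = short (≤-trans
          (s≤s⁻¹ (least (chord-collision d q ring′ i′≤q j′≤q e d-inj
            (λ eq → step-≢ (trans (sym (+-suc (suc p) i′)) (cong (suc p +_) eq)))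
            λ { (refl , refl) → ¬d (back₂ (trans (sym (+-suc (suc p) q)) (cong (_+ suc q) (sym (+-identityʳ (suc p)))))) })))
          (≤-trans (m≤n+m (suc q) (suc p)) (≤-reflexive size)))
        cases (no i≰p) (yes j≤p) with position i<n i≰p
        ... | i′ , refl , i′≤q = short (≤-trans (ear {suc i′} j≤p
            (steps-walk g steps i′ (<⇒≤ i<n) ▷ e)
            (walk-≡ (cong suc (+-comm (suc p) i′)) (steps-walk g steps (suc p + i′) (<⇒≤ i<n) ▷ e)))
          (≤-trans (≤-reflexive (cong suc (+-comm i′ (suc p)))) i<n))
        cases (yes i≤p) (no j≰p) with position j<n j≰p
        ... | j′ , refl , j′≤q with coprime? (suc p) (suc q)
        ...   | no ¬coprime = half (suc p) (suc q) (s≤s z≤n) (s≤s z≤n) size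
                (≤-trans (+-mono-≤ k≤lcm k≤lcm) (¬coprime⇒2lcm≤* (suc p) (suc q) ¬coprime))
        ...   | yes coprime = half (suc p) (suc q) (s≤s z≤n) (s≤s z≤n) size
                (second-bridge least g p ring d q ring′
                  (λ {a} {b} a≤p b≤q → inj a (suc p + b) (s≤s (≤-trans a≤p (m≤m+n p b))) (in-range b≤q))
                  (subst (E (g p)) (sym d-start) (steps p p<n)) i≤p j′≤q e
                  (λ { (refl , refl) → step-≢ (sym (+-identityʳ (suc p))) }) coprime)

    exit-outcome : Outcome n k
    exit-outcome with first-repeat g
    ... | T , T≤n , j , j<T , gj≡gT , inj with T ≤? p
    ... | yes T≤p = contradiction gj≡gT (simple j T j<T (s≤s T≤p))
    ... | no  T≰p with j ≤? p
    ...   | yes j≤p with m≤n⇒∃[o]m+o≡n (≰⇒> T≰p)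
    ...     | a , refl = short (≤-trans (ear j≤p
                (subst (Walk E a _) (sym gj≡gT) (steps-walk g steps a T≤n))
                (walk-≡ (+-comm (suc p) a) (subst (Walk E (suc p + a) _) (sym gj≡gT) (steps-walk g steps (suc p + a) T≤n))))
              (≤-trans (≤-reflexive (+-comm a (suc p))) T≤n))
    exit-outcome | T , T≤n , j , j<T , gj≡gT , inj | no T≰p | no j≰p
      with m≤n⇒∃[o]m+o≡n (≰⇒> j≰p)
    ... | r , refl with m≤n⇒∃[o]m+o≡n j<T
    ... | q , refl with m≤n⇒∃[o]m+o≡n T≤n
    ... | x , size = finish r x refl refl
      where
      close : E (g (suc p + r + q)) (g (suc p + r))
      close = subst (E _) (sym gj≡gT) (steps (suc p + r + q) T≤n)

      k≤lcm+r : k ≤ lcm (suc p) (suc q) + r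
      k≤lcm+r = dumbbell r q T≤n close

      -- `x` counts the vertices missed before the first repetition. Counting them as inner vertices
      -- of the path only weakens the bound and fills up the order `n`.
      finish : ∀ r′ x′ → r′ ≡ r → x′ ≡ x → Outcome n k
      finish zero zero refl refl = spanning q (trans (shuffle p q) size)
        (subst (InjectiveBelow g) (trans (sym (+-identityʳ _)) size) inj)
        (subst (λ i → E (g (i + q)) (g i)) (+-identityʳ (suc p)) close)
        (subst (k ≤_) (+-identityʳ _) k≤lcm+r)
        where
        shuffle : ∀ p q → suc p + suc q ≡ suc (suc p + 0 + q) + 0
        shuffle = solve-∀
      finish zero (suc x) refl refl = long (suc p) (suc x) (suc q) (s≤s z≤n) (s≤s z≤n) (s≤s z≤n)
        (trans (shuffle p x q) size) (≤-trans k≤lcm+r (+-monoʳ-≤ (lcm (suc p) (suc q)) z≤n))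
        where
        shuffle : ∀ p x q → suc p + suc x + suc q ≡ suc (suc p + 0 + q) + suc x
        shuffle = solve-∀
      finish (suc r) x refl refl = long (suc p) (suc r + x) (suc q) (s≤s z≤n) (s≤s z≤n) (s≤s z≤n)
        (trans (shuffle p r x q) size) (≤-trans k≤lcm+r (+-monoʳ-≤ (lcm (suc p) (suc q)) (m≤m+n (suc r) x)))
        where
        shuffle : ∀ p r x q → suc p + (suc r + x) + suc q ≡ suc (suc p + suc r + q) + x
        shuffle = solve-∀

-- Minimal collisions without an exit from a cycle

opaque
  least-witness : {P : ℕ → Set} → (∀ t → Dec (P t)) → ∀ {N} → P N → ∃ λ s → s ≤ N × P s × (∀ t → t < s → ¬ P t)
  least-witness {P} P? {N} pN = [ (λ none → contradiction pN (none N ≤-refl)) , (λ (s , s<1+N , found) → s , s≤s⁻¹ s<1+N , found) ]′ (search (suc N))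
    where
    search : ∀ M → (∀ t → t < M → ¬ P t) ⊎ ∃ λ s → s < M × P s × (∀ t → t < s → ¬ P t)
    search zero = inj₁ λ _ ()
    search (suc M) with search M
    ... | inj₂ (s , s<M , found) = inj₂ (s , m≤n⇒m≤1+n s<M , found)
    ... | inj₁ none with P? M
    ...   | yes pM = inj₂ (M , ≤-refl , pM , none)
    ...   | no ¬pM = inj₁ λ t t≤M → [ none t , (λ { refl → ¬pM }) ]′ (m≤n⇒m<n∨m≡n (s≤s⁻¹ t≤M))

opaque
  walk-split : ∀ a b {x y : V} → Walk E (a + b) x y → ∃ λ z → Walk E a x z × Walk E b z y
  walk-split a zero    w = _ , walk-≡ (+-identityʳ a) w , ε
  walk-split {E = E} a (suc b) {x} {y} w = split (walk-≡ (+-suc a b) w)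
    where
    split : Walk E (suc (a + b)) x y → ∃ λ z → Walk E a x z × Walk E (suc b) z y
    split (w ▷ e) with walk-split a b w
    ... | z , w₁ , w₂ = z , w₁ , w₂ ▷ e

visit-walk-≡ : ∀ {k l} {x y : V} (eq : k ≡ l) (w : Walk E k x y) t → visit (walk-≡ eq w) t ≡ visit w t
visit-walk-≡ refl w t = refl

visit-++ : ∀ {a b} {x y z : V} (w : Walk E a x y) (w′ : Walk E b y z) → visit (w ++ʷ w′) a ≡ y
visit-++ {a = a} w ε = trans (visit-walk-≡ (sym (+-identityʳ a)) w a) (visit-last w)
visit-++ {a = a} {suc b} w (w′ ▷ e) =
  trans (visit-walk-≡ (sym (+-suc a b)) (w ++ʷ w′ ▷ e) a) go
  where
  go : visit (w ++ʷ w′ ▷ e) a ≡ _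
  go with a ≤? a + b
  ... | yes _ = visit-++ w w′
  ... | no ≰  = contradiction (m≤m+n a b) ≰

walk? : ∀ {n} {E : Rel (Fin n) 0ℓ} → B.Decidable E → ∀ l → B.Decidable (Walk E l)
walk? E? zero    x y = map′ (λ { refl → ε }) (λ { ε → refl }) (x Fin.≟ y)
walk? E? (suc l) x y = map′ (λ (z , w , e) → w ▷ e) (λ { (w ▷ e) → _ , w , e })
  (Fin.any? λ z → walk? E? l x z ×-dec E? z y)

-- By pigeonhole, a walk with n edges on n vertices meets a cycle.
Ahead : ∀ {n} → Rel (Fin n) 0ℓ → Fin n → Set
Ahead {n} E v = ∃ λ y → Walk E n v y

Behind : ∀ {n} → Rel (Fin n) 0ℓ → Fin n → Set
Behind E = Ahead (flip E)

ahead? : ∀ {n} {E : Rel (Fin n) 0ℓ} → B.Decidable E → ∀ v → Dec (Ahead E v)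
ahead? {n} E? v = Fin.any? λ y → walk? E? n v y

walk-ahead : ∀ {n l v w} {E : Rel (Fin n) 0ℓ} → Walk E l v w → Ahead E w → Ahead E v
walk-ahead {n} {l} w (y , w′) with walk-split n l (walk-≡ (+-comm l n) (w ++ʷ w′))
... | z , w₁ , _ = z , w₁

walk-behind : ∀ {n l v w} {E : Rel (Fin n) 0ℓ} → Walk E l v w → Behind E v → Behind E w
walk-behind w = walk-ahead (walk-flip w)

loop-ahead : ∀ {n p v} {E : Rel (Fin n) 0ℓ} → Walk E (suc p) v v → Ahead E v
loop-ahead {n} {p} w with walk-split n (n * p) (walk-≡ (*-suc n p) (walk-iterate w n))
... | z , w₁ , _ = z , w₁

loop-behind : ∀ {n p v} {E : Rel (Fin n) 0ℓ} → Walk E (suc p) v v → Behind E v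
loop-behind w = loop-ahead (walk-flip w)

module _ {n k : ℕ} {E : Rel (Fin n) 0ℓ} (E? : B.Decidable E)
         (collision : Collision E (suc k)) (least : ∀ {m} → Collision E m → suc k ≤ m)
         (¬outcome : ¬ Outcome n k) where

  opaque
    -- Otherwise the ring followed by the long walk from `w` leaves the cycle, and `exit-outcome`
    -- applies. So a cycle can be left only towards vertices without a future.
    no-exit : ∀ {c p w} → Ring E c p → InjectiveBelow c (suc p) → E (c p) w → Ahead E w → w ≡ c 0
    no-exit {c} {p} {w} (steps , back) inj e (_ , walk) with w Fin.≟ c 0
    ... | yes eq = eq
    ... | no neq = contradiction
          (exit-outcome E? collision least g p (injectiveBelow-≤ c inj) g-steps g-back g-leaves g-inj) ¬outcome
      where
      g : ℕ → Fin n
      g t with t ≤? p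
      ... | yes _ = c t
      ... | no  _ = visit walk (t ∸ suc p)

      g-≤ : ∀ {t} → t ≤ p → g t ≡ c t
      g-≤ {t} t≤p with t ≤? p
      ... | yes _ = refl
      ... | no ≰p = contradiction t≤p ≰p

      g-> : ∀ s → g (suc p + s) ≡ visit walk s
      g-> s with suc p + s ≤? p
      ... | yes le = contradiction (≤-trans (s≤s (m≤m+n p s)) le) (<-irrefl refl)
      ... | no  _  = cong (visit walk) (m+n∸m≡n (suc p) s)

      g-exit : g (suc p) ≡ w
      g-exit = trans (cong g (sym (+-identityʳ (suc p)))) (trans (g-> 0) (visit-first walk))

      g-steps : Steps E g n
      g-steps t t<n with <-cmp t p
      ... | tri< t<p _ _  = subst₂ E (sym (g-≤ (<⇒≤ t<p))) (sym (g-≤ t<p)) (steps t t<p)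
      ... | tri≈ _ refl _ = subst₂ E (sym (g-≤ ≤-refl)) (sym g-exit) e
      ... | tri> _ _ p<t with m≤n⇒∃[o]m+o≡n p<t
      ...   | s , refl = subst₂ E (sym (g-> s)) (sym (trans (cong g (sym (+-suc (suc p) s))) (g-> (suc s))))
                (visit-steps walk s (≤-<-trans (m≤n+m s (suc p)) t<n))

      g-back : E (g p) (g 0)
      g-back = subst₂ E (sym (g-≤ ≤-refl)) (sym (g-≤ z≤n)) back

      g-leaves : g (suc p) ≢ g 0
      g-leaves eq = neq (trans (sym g-exit) (trans eq (g-≤ z≤n)))

      g-inj : InjectiveBelow g (suc p)
      g-inj i j i<j j≤p eq = inj i j i<j j≤p
        (trans (sym (g-≤ (<⇒≤ (<-≤-trans i<j (s≤s⁻¹ j≤p))))) (trans eq (g-≤ (s≤s⁻¹ j≤p))))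

  Cycle : Fin n → Set
  Cycle v = ∃₂ λ c p → Ring E c p × InjectiveBelow c (suc p) × c p ≡ v

  opaque
    -- A walk is followed backwards from `v` to its first repetition `b j ≡ b (suc T)`; reversed,
    -- the repeating part is a ring ending in `b j`. If `j > 0`, the edge from `b j` towards `v`
    -- leads to a vertex with a future, so `no-exit` identifies that vertex with `b T`, against the
    -- choice of the first repetition.
    recurrent : ∀ {v} → Ahead E v → Behind E v → Cycle v
    recurrent {v} ahead (_ , walk) with first-repeat (visit walk)
    ... | zero  , _   , _ , () , _
    ... | suc T , T≤n , j , s≤s j≤T , eq , inj = cycle j j≤T eq
      where
      b : ℕ → Fin n
      b = visit walk

      b-step : ∀ {t} → t ≤ T → E (b (suc t)) (b t)
      b-step {t} t≤T = visit-steps walk t (≤-trans (s≤s t≤T) T≤n)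

      b-walk : ∀ t → t ≤ T → Walk E t (b t) v
      b-walk t t≤T = subst (Walk E t (b t)) (visit-first walk)
        (walk-flip (steps-walk b (λ s s<T → b-step (<⇒≤ s<T)) t t≤T))

      cycle : ∀ j → j ≤ T → b j ≡ b (suc T) → Cycle v
      cycle j j≤T eq = finish j refl
        where
        c : ℕ → Fin n
        c t = b (T ∸ t)
        p : ℕ
        p = T ∸ j

        c-end : c p ≡ b j
        c-end = cong b (m∸[m∸n]≡n j≤T)

        c-ring : Ring E c p
        c-ring = (λ t t<p → subst (λ i → E (b i) (c (suc t))) (suc-∸ (<-≤-trans t<p (m∸n≤m T j))) (b-step (m∸n≤m T (suc t)))) ,
                 subst (λ x → E x (b T)) (trans (sym eq) (sym c-end)) (b-step ≤-refl)
          where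
          suc-∸ : ∀ {t} → t < T → suc (T ∸ suc t) ≡ T ∸ t
          suc-∸ t<T = sym (∸-suc t<T)

        c-inj : InjectiveBelow c (suc p)
        c-inj i i′ i<i′ i′≤p eq′ = inj (T ∸ i′) (T ∸ i) (∸-monoʳ-< i<i′ (≤-trans (s≤s⁻¹ i′≤p) (m∸n≤m T j))) (s≤s (m∸n≤m T i)) (sym eq′)

        finish : ∀ i → i ≡ j → Cycle v
        finish zero refl = c , p , c-ring , c-inj , trans c-end (visit-first walk)
        finish (suc i) refl = contradiction
          (no-exit c-ring c-inj (subst (λ x → E x (b i)) (sym c-end) (b-step (<⇒≤ j≤T))) (walk-ahead (b-walk i (<⇒≤ j≤T)) ahead))
          (inj i T j≤T ≤-refl)

  unique-successor : ∀ {v w w′} → Behind E v → E v w → E v w′ → Ahead E w → Ahead E w′ → w ≡ w′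
  unique-successor behind e e′ ahead ahead′ with recurrent (walk-ahead (ε ▷ e) ahead) behind
  ... | c , p , ring , inj , refl = trans (no-exit ring inj e ahead) (sym (no-exit ring inj e′ ahead′))

  opaque
    -- A vertex with a past that has a successor with a future lies on a cycle, where `no-exit`
    -- leaves one such successor. So from a vertex with a past, walks have no choice as long as a
    -- future remains.
    deterministic : ∀ {l v y y′} → Behind E v → Walk E l v y → Walk E l v y′ → Ahead E y → Ahead E y′ → y ≡ y′
    deterministic behind ε       ε         _     _      = refl
    deterministic behind (w ▷ e) (w′ ▷ e′) ahead ahead′
      with deterministic behind w w′ (walk-ahead (ε ▷ e) ahead) (walk-ahead (ε ▷ e′) ahead′)
    ... | refl = unique-successor (walk-behind w behind) e e′ ahead ahead′

module _ {n k : ℕ} {E : Rel (Fin n) 0ℓ} (E? : B.Decidable E)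
         (collision : Collision E (suc k)) (least : ∀ {m} → Collision E m → suc k ≤ m)
         (¬outcome : ¬ Outcome n k) where

  private
    L = suc k

    n<k : n < k
    n<k = ≰⇒> λ k≤n → ¬outcome (short k≤n)

    n<L : n < L
    n<L = m≤n⇒m≤1+n n<k

    Behind? : ∀ v → Dec (Behind E v)
    Behind? = ahead? (flip E?)

    Ahead? : ∀ v → Dec (Ahead E v)
    Ahead? = ahead? E?

    module Run (W : ℕ → Fin n) (steps : Steps E W L) where

      run : ∀ {i j} → i ≤ j → j ≤ L → Walk E (j ∸ i) (W i) (W j)
      run = steps-walk′ W steps

      loop : ∀ {i j} → i < j → j ≤ L → W i ≡ W j → ∃ λ p → Walk E (suc p) (W i) (W i)
      loop {i} {j} i<j j≤L eq = j ∸ suc i ,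
        walk-≡ (∸-suc i<j) (subst (Walk E (j ∸ i) (W i)) (sym eq) (run (<⇒≤ i<j) j≤L))

      late-behind : Behind E (W n)
      late-behind = _ , walk-flip (run z≤n (<⇒≤ n<L))

      early-ahead : Ahead E (W (L ∸ n))
      early-ahead = _ , walk-≡ (m∸[m∸n]≡n (<⇒≤ n<L)) (run (m∸n≤m L n) ≤-refl)

      -- A vertex repeats; times without a past precede it, hence have a future.
      ¬behind⇒ahead : ∀ t → t ≤ L → ¬ Behind E (W t) → Ahead E (W t)
      ¬behind⇒ahead t t≤L ¬behind with first-repeat W
      ... | T , T≤n , j , j<T , eq , _ with loop j<T (≤-trans T≤n (<⇒≤ n<L)) eq
      ...   | p , cycle with t ≤? j
      ...     | yes t≤j = walk-ahead (run t≤j (≤-trans (<⇒≤ j<T) (≤-trans T≤n (<⇒≤ n<L)))) (loop-ahead cycle)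
      ...     | no  t≰j = contradiction (walk-behind (run (≰⇒≥ t≰j) t≤L) (loop-behind cycle)) ¬behind

      before-inj : ∀ {s} → s ≤ L → (∀ t → t < s → ¬ Behind E (W t)) → InjectiveBelow W s
      before-inj s≤L ¬behind i j i<j j<s eq with loop i<j (≤-trans (<⇒≤ j<s) s≤L) eq
      ... | p , cycle = ¬behind i (<-trans i<j j<s) (loop-behind cycle)

      after-inj : ∀ {f} → f ≤ L → (∀ t → t < f → ¬ Ahead E (W (L ∸ t))) → InjectiveBelow (λ t → W (L ∸ t)) f
      after-inj f≤L ¬ahead i j i<j j<f eq with loop (∸-monoʳ-< i<j (≤-trans (<⇒≤ j<f) f≤L)) (m∸n≤m L i) (sym eq)
      ... | p , cycle = ¬ahead j j<f (loop-ahead cycle)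

    opaque
      -- The early times, the late times and `xs` supply distinct vertices: a repetition would lie
      -- on a cycle and have both past and future, and a vertex of `Z` without a past has a future
      -- by `¬behind⇒ahead`.
      crowd : ∀ {s f xs} {Z Z′ : ℕ → Fin n} → Steps E Z L → Steps E Z′ L → s ≤ L → f ≤ L →
              (∀ t → t < s → ¬ Behind E (Z t)) → (∀ t → t < f → ¬ Ahead E (Z′ (L ∸ t))) →
              Unique xs → (∀ {v} → v ∈ xs → Ahead E v × Behind E v) → s + (f + length xs) ≤ n
      crowd {s} {f} {xs} {Z} {Z′} steps steps′ s≤L f≤L ¬behind ¬ahead xs! recurring =
        subst (_≤ n) size (unique-length≤ (Unique.++⁺ before! (Unique.++⁺ after! xs! after#xs) before#rest))
        where
        before after : List (Fin n)
        before = applyUpTo Z s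
        after  = applyUpTo (λ t → Z′ (L ∸ t)) f

        size : length (before ++ after ++ xs) ≡ s + (f + length xs)
        size = trans (length-++ before) (cong₂ _+_ (length-applyUpTo Z s)
          (trans (length-++ after) (cong (_+ length xs) (length-applyUpTo _ f))))

        before! : Unique before
        before! = Unique.applyUpTo⁺₁ Z s λ {i} {j} → Run.before-inj Z steps s≤L ¬behind i j

        after! : Unique after
        after! = Unique.applyUpTo⁺₁ _ f λ {i} {j} → Run.after-inj Z′ steps′ f≤L ¬ahead i j

        after#xs : ∀ {v} → v ∈ after × v ∈ xs → ⊥
        after#xs (v∈after , v∈xs) with ∈-applyUpTo⁻ _ v∈after
        ... | t , t<f , refl = ¬ahead t t<f (proj₁ (recurring v∈xs))

        before#rest : ∀ {v} → v ∈ before × v ∈ (after ++ xs) → ⊥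
        before#rest (v∈before , v∈rest) with ∈-applyUpTo⁻ _ v∈before | ∈-++⁻ after v∈rest
        ... | t , t<s , refl | inj₂ v∈xs = ¬behind t t<s (proj₂ (recurring v∈xs))
        ... | t , t<s , refl | inj₁ v∈after with ∈-applyUpTo⁻ _ v∈after
        ...   | t′ , t′<f , eq = ¬ahead t′ t′<f (subst (Ahead E) eq
                (Run.¬behind⇒ahead Z steps t (≤-trans (<⇒≤ t<s) s≤L) (¬behind t t<s)))

    -- At each time before entry one of the two walks lacks a past. As a past is never lost, the
    -- walk lacking it at the last such time lacks it throughout, so `crowd` can count its vertices;
    -- likewise for the future.
    pick : {P Q : ℕ → Set} → (∀ t → Dec (P t)) → ∀ s → (∀ t → t < s → ¬ (P t × Q t)) →
           (∀ {t t′} → t ≤ t′ → t′ < s → P t → P t′) → (∀ {t t′} → t ≤ t′ → t′ < s → Q t → Q t′) →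
           (∀ t → t < s → ¬ P t) ⊎ (∀ t → t < s → ¬ Q t)
    pick P? zero    _     _     _     = inj₁ λ _ ()
    pick P? (suc s) ¬both monoP monoQ with P? s
    ... | no ¬p = inj₁ λ t t≤s pt → ¬p (monoP (s≤s⁻¹ t≤s) ≤-refl pt)
    ... | yes p = inj₂ λ t t≤s qt → ¬both s ≤-refl (p , monoQ (s≤s⁻¹ t≤s) ≤-refl qt)

    ring-recurring : ∀ {c p} → Ring E c p → ∀ {v} → v ∈ applyUpTo c (suc p) → Ahead E v × Behind E v
    ring-recurring {c} {p} ring v∈ with ∈-applyUpTo⁻ c v∈
    ... | i , i<1+p , refl = loop-ahead (ring-loop c p ring (s≤s⁻¹ i<1+p)) , loop-behind (ring-loop c p ring (s≤s⁻¹ i<1+p))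

    module Race (W₁ W₂ : ℕ → Fin n) (steps₁ : Steps E W₁ L) (steps₂ : Steps E W₂ L)
                (start : W₁ 0 ≡ W₂ 0) (finish : W₁ L ≡ W₂ L)
                (apart : ∀ t → 0 < t → t < L → W₁ t ≢ W₂ t) where

      module R₁ = Run W₁ steps₁
      module R₂ = Run W₂ steps₂

      entry : ∃ λ s → s ≤ n × (Behind E (W₁ s) × Behind E (W₂ s)) ×
                      (∀ t → t < s → ¬ (Behind E (W₁ t) × Behind E (W₂ t)))
      entry = least-witness (λ t → Behind? (W₁ t) ×-dec Behind? (W₂ t)) (R₁.late-behind , R₂.late-behind)

      exit : ∃ λ f → f ≤ n × (Ahead E (W₁ (L ∸ f)) × Ahead E (W₂ (L ∸ f))) ×
                     (∀ t → t < f → ¬ (Ahead E (W₁ (L ∸ t)) × Ahead E (W₂ (L ∸ t))))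
      exit = least-witness (λ t → Ahead? (W₁ (L ∸ t)) ×-dec Ahead? (W₂ (L ∸ t))) (R₁.early-ahead , R₂.early-ahead)

      -- From `σ` on both walks have a past, and up to `τ` both have a future; in between they are
      -- deterministic.
      σ = proj₁ entry
      φ = proj₁ exit
      τ = L ∸ φ

      σ≤n : σ ≤ n
      σ≤n = proj₁ (proj₂ entry)
      φ≤n : φ ≤ n
      φ≤n = proj₁ (proj₂ exit)
      σ≤L : σ ≤ L
      σ≤L = ≤-trans σ≤n (<⇒≤ n<L)
      φ≤L : φ ≤ L
      φ≤L = ≤-trans φ≤n (<⇒≤ n<L)

      ¬behind : (∀ t → t < σ → ¬ Behind E (W₁ t)) ⊎ (∀ t → t < σ → ¬ Behind E (W₂ t))
      ¬behind = pick (λ t → Behind? (W₁ t)) σ (proj₂ (proj₂ (proj₂ entry)))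
        (λ t≤t′ t′<σ → walk-behind (R₁.run t≤t′ (≤-trans (<⇒≤ t′<σ) σ≤L)))
        (λ t≤t′ t′<σ → walk-behind (R₂.run t≤t′ (≤-trans (<⇒≤ t′<σ) σ≤L)))

      ¬ahead : (∀ t → t < φ → ¬ Ahead E (W₁ (L ∸ t))) ⊎ (∀ t → t < φ → ¬ Ahead E (W₂ (L ∸ t)))
      ¬ahead = pick (λ t → Ahead? (W₁ (L ∸ t))) φ (proj₂ (proj₂ (proj₂ exit)))
        (λ {t} t≤t′ _ → walk-ahead (R₁.run (∸-monoʳ-≤ L t≤t′) (m∸n≤m L t)))
        (λ {t} t≤t′ _ → walk-ahead (R₂.run (∸-monoʳ-≤ L t≤t′) (m∸n≤m L t)))

      opaque
        room : ∀ {xs} → Unique xs → (∀ {v} → v ∈ xs → Ahead E v × Behind E v) → σ + (φ + length xs) ≤ n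
        room xs! recurring with ¬behind | ¬ahead
        ... | inj₁ b | inj₁ a = crowd steps₁ steps₁ σ≤L φ≤L b a xs! recurring
        ... | inj₁ b | inj₂ a = crowd steps₁ steps₂ σ≤L φ≤L b a xs! recurring
        ... | inj₂ b | inj₁ a = crowd steps₂ steps₁ σ≤L φ≤L b a xs! recurring
        ... | inj₂ b | inj₂ a = crowd steps₂ steps₂ σ≤L φ≤L b a xs! recurring

      opaque
        σ<τ : σ < τ
        σ<τ = +-cancelʳ-< φ σ τ (≤-<-trans (≤-trans (≤-reflexive (cong (σ +_) (sym (+-identityʳ φ)))) (room [] λ ()))
                (<-≤-trans n<L (≤-reflexive (sym (m∸n+n≡m φ≤L)))))

        τ≤L : τ ≤ L
        τ≤L = m∸n≤m L φ

        behind₁ : Behind E (W₁ σ)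
        behind₁ = proj₁ (proj₁ (proj₂ (proj₂ entry)))
        behind₂ : Behind E (W₂ σ)
        behind₂ = proj₂ (proj₁ (proj₂ (proj₂ entry)))
        ahead₁ : ∀ {t} → t ≤ τ → Ahead E (W₁ t)
        ahead₁ t≤τ = walk-ahead (R₁.run t≤τ τ≤L) (proj₁ (proj₁ (proj₂ (proj₂ exit))))
        ahead₂ : ∀ {t} → t ≤ τ → Ahead E (W₂ t)
        ahead₂ t≤τ = walk-ahead (R₂.run t≤τ τ≤L) (proj₂ (proj₁ (proj₂ (proj₂ exit))))

        0<σ : 0 < σ
        -- If the common start had a past, `deterministic` would make the walks agree after one
        -- step.
        0<σ = n≢0⇒n>0 λ σ≡0 → apart 1 ≤-refl (s≤s (≤-trans (s≤s z≤n) n<k))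
          (deterministic E? collision least ¬outcome (subst (λ t → Behind E (W₁ t)) σ≡0 behind₁)
            (R₁.run z≤n (s≤s z≤n)) (subst (λ v → Walk E 1 v (W₂ 1)) (sym start) (R₂.run z≤n (s≤s z≤n)))
            (ahead₁ (≤-trans (s≤s z≤n) σ<τ)) (ahead₂ (≤-trans (s≤s z≤n) σ<τ)))

        -- Both walks repeat after a common period, which can be cut out of them.

      opaque
        period-bound : ∀ m → 0 < m → Walk E m (W₁ σ) (W₁ σ) → Walk E m (W₂ σ) (W₂ σ) → L < σ + m + φ
        period-bound m 0<m loop₁ loop₂ = ≰⇒> λ s+m+f≤L →
          let s+m≤e : σ + m ≤ τ
              s+m≤e = +-cancelʳ-≤ φ (σ + m) τ (≤-trans s+m+f≤L (≤-reflexive (sym (m∸n+n≡m φ≤L))))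
              s+m≤L = ≤-trans s+m≤e τ≤L
              length-m : σ + m ∸ σ ≡ m
              length-m = m+n∸m≡n σ m
              eq₁ : W₁ (σ + m) ≡ W₁ σ
              eq₁ = deterministic E? collision least ¬outcome behind₁
                      (walk-≡ length-m (R₁.run (m≤m+n σ m) s+m≤L)) loop₁ (ahead₁ s+m≤e) (ahead₁ (<⇒≤ σ<τ))
              eq₂ : W₂ (σ + m) ≡ W₂ σ
              eq₂ = deterministic E? collision least ¬outcome behind₂
                      (walk-≡ length-m (R₂.run (m≤m+n σ m) s+m≤L)) loop₂ (ahead₂ s+m≤e) (ahead₂ (<⇒≤ σ<τ))
              shorter : Collision E (σ + (L ∸ (σ + m)))
              shorter = mkCollision refl (apart σ 0<σ (<-≤-trans σ<τ τ≤L))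
                          (R₁.run z≤n σ≤L) (subst (λ v → Walk E σ v (W₂ σ)) (sym start) (R₂.run z≤n σ≤L))
                          (subst (λ v → Walk E (L ∸ (σ + m)) v (W₁ L)) eq₁ (R₁.run s+m≤L ≤-refl))
                          (subst₂ (Walk E (L ∸ (σ + m))) eq₂ (sym finish) (R₂.run s+m≤L ≤-refl))
          in <-irrefl refl (<-≤-trans (<-≤-trans (+-monoˡ-< (L ∸ (σ + m)) (m<m+n σ 0<m)) (≤-reflexive (m+[n∸m]≡n s+m≤L)))
                                      (least shorter))

      Meeting : (c d : ℕ → Fin n) (p q : ℕ) → Set
      Meeting c d p q = ∃ λ i → i < suc p × ∃ λ j → j < suc q × c i ≡ d j

      -- At time `σ` both walks are on cycles. If these meet, the length of the first is a common
      -- period, and `period-bound` with `room` gives `L < n`. If they are disjoint, the lcm is a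
      -- common period, and the `σ + φ + x` remaining vertices, at least one by `0<σ`, act as inner
      -- vertices in `long`.
      impossible : ⊥
      impossible = cycles (recurrent E? collision least ¬outcome (ahead₁ (<⇒≤ σ<τ)) behind₁)
                          (recurrent E? collision least ¬outcome (ahead₂ (<⇒≤ σ<τ)) behind₂)
        where
        cycles : Cycle E? collision least ¬outcome (W₁ σ) → Cycle E? collision least ¬outcome (W₂ σ) → ⊥
        cycles (c , p , ring , inj , c-end) (d , q , ring′ , inj′ , d-end) =
          [ together , separate ]′ (toSum (anyUpTo? (λ i → anyUpTo? (λ j → c i Fin.≟ d j) (suc q)) (suc p)))
          where
          together : Meeting c d p q → ⊥
          together (i , i≤p , j , j≤q , meet) = <-asym n<L (<-≤-trans
                  (period-bound (suc p) (s≤s z≤n) loop₁ loop₂)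
                  (≤-trans (≤-reflexive (trans (+-assoc σ (suc p) φ) (cong (σ +_) (trans (+-comm (suc p) φ) (cong (φ +_) (sym (length-applyUpTo c (suc p))))))))
                    (room (Unique.applyUpTo⁺₁ c (suc p) λ {i} {j} → inj i j) (ring-recurring ring))))
            where
            loop₁ : Walk E (suc p) (W₁ σ) (W₁ σ)
            loop₁ = subst (λ v → Walk E (suc p) v v) c-end (ring-loop c p ring ≤-refl)
            loop₂ : Walk E (suc p) (W₂ σ) (W₂ σ)
            along : Walk E (q ∸ j) (d j) (d q)
            along = steps-walk′ d (proj₁ ring′) (s≤s⁻¹ j≤q) ≤-refl

            -- From the common vertex, turning before or after going along to d q amounts to the same.
            closes : (∃ λ y → Walk E (suc p) (d q) y × Walk E (suc p * q) y (d q)) → Walk E (suc p) (d q) (d q)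
            closes (y , w , w′) = subst (Walk E (suc p) (d q)) (sym (deterministic E? collision least ¬outcome
              (loop-behind (ring-loop d q ring′ (s≤s⁻¹ j≤q)))
              (subst (λ v → Walk E (suc p) v v) meet (ring-loop c p ring (s≤s⁻¹ i≤p)) ++ʷ along)
              (walk-≡ (+-comm (q ∸ j) (suc p)) (along ++ʷ w))
              (loop-ahead (ring-loop d q ring′ ≤-refl)) (walk-ahead w′ (loop-ahead (ring-loop d q ring′ ≤-refl))))) w

            loop₂ = subst (λ v → Walk E (suc p) v v) d-end (closes (walk-split (suc p) (suc p * q)
              (walk-≡ (*-suc (suc p) q) (walk-iterate (ring-loop d q ring′ ≤-refl) (suc p)))))

          separate : ¬ Meeting c d p q → ⊥
          separate ¬meet with m∣lcm[m,n] (suc p) (suc q) | n∣lcm[m,n] (suc p) (suc q)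
          ... | divides i lcm≡ip | divides j lcm≡jq = count (m≤n⇒∃[o]m+o≡n (room
                  (Unique.++⁺ (Unique.applyUpTo⁺₁ c (suc p) λ {i} {j} → inj i j)
                              (Unique.applyUpTo⁺₁ d (suc q) λ {i} {j} → inj′ i j) disjoint)
                  ([ ring-recurring ring , ring-recurring ring′ ]′ ∘ ∈-++⁻ (applyUpTo c (suc p)))))
            where
            disjoint : ∀ {v} → v ∈ applyUpTo c (suc p) × v ∈ applyUpTo d (suc q) → ⊥
            disjoint (v∈c , v∈d) with ∈-applyUpTo⁻ c v∈c | ∈-applyUpTo⁻ d v∈d
            ... | i , i≤p , refl | j , j≤q , eq = ¬meet (i , i≤p , j , j≤q , eq)

            count : (∃ λ x → σ + (φ + length (applyUpTo c (suc p) ++ applyUpTo d (suc q))) + x ≡ n) → ⊥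
            count (x , size) = ¬outcome (long (suc p) (σ + φ + x) (suc q) (s≤s z≤n)
                    (≤-trans 0<σ (≤-trans (m≤m+n σ φ) (m≤m+n (σ + φ) x))) (s≤s z≤n) total bound)
              where
              total : suc p + (σ + φ + x) + suc q ≡ n
              total = trans (shuffle p σ φ x q) (trans (cong (λ l → σ + (φ + l) + x) (sym (trans (length-++ (applyUpTo c (suc p)))
                (cong₂ _+_ (length-applyUpTo c (suc p)) (length-applyUpTo d (suc q)))))) size)
                where
                shuffle : ∀ p σ φ x q → suc p + (σ + φ + x) + suc q ≡ σ + (φ + (suc p + suc q)) + x
                shuffle = solve-∀
              bound : k ≤ lcm (suc p) (suc q) + (σ + φ + x)
              bound = ≤-trans (n≤1+n k) (≤-trans (<⇒≤ (period-bound (lcm (suc p) (suc q))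
                  (>-nonZero⁻¹ _ {{lcm-nonZero (suc p) (suc q)}})
                  (walk-≡ (sym lcm≡ip) (walk-iterate (subst (λ v → Walk E (suc p) v v) c-end (ring-loop c p ring ≤-refl)) i))
                  (walk-≡ (sym lcm≡jq) (walk-iterate (subst (λ v → Walk E (suc q) v v) d-end (ring-loop d q ring′ ≤-refl)) j))))
                (≤-trans (m≤m+n _ x) (≤-reflexive (shuffle σ (lcm (suc p) (suc q)) φ x))))
                where
                shuffle : ∀ σ c φ x → σ + c + φ + x ≡ c + (σ + φ + x)
                shuffle = solve-∀

  ¬¬outcome : ⊥
  ¬¬outcome = go collision
    where
    go : Collision E L → ⊥
    go (mkCollision {x} {y} {u} {v} {a} {b} a+b≡L u≢v x↝u x↝v u↝y v↝y) =
      Race.impossible (visit w₁) (visit w₂) (visit-steps w₁) (visit-steps w₂)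
        (trans (visit-first w₁) (sym (visit-first w₂))) (trans (visit-last w₁) (sym (visit-last w₂))) apart
      where
      w₁ w₂ : Walk E L x y
      w₁ = walk-≡ a+b≡L (x↝u ++ʷ u↝y)
      w₂ = walk-≡ a+b≡L (x↝v ++ʷ v↝y)

      at-u : visit w₁ a ≡ u
      at-u = trans (visit-walk-≡ a+b≡L (x↝u ++ʷ u↝y) a) (visit-++ x↝u u↝y)
      at-v : visit w₂ a ≡ v
      at-v = trans (visit-walk-≡ a+b≡L (x↝v ++ʷ v↝y) a) (visit-++ x↝v v↝y)

      a≤L : a ≤ L
      a≤L = subst (a ≤_) a+b≡L (m≤m+n a b)

      -- If the walks met at an inner time `t`, the collision could start there when `t ≤ a`, or end
      -- there otherwise, and would be shorter.
      apart : ∀ t → 0 < t → t < L → visit w₁ t ≢ visit w₂ t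
      apart t 0<t t<L eq with t ≤? a
      ... | yes t≤a = <-irrefl refl (≤-<-trans (least (mkCollision refl u≢v
              (subst (Walk E (a ∸ t) (visit w₁ t)) at-u (steps-walk′ (visit w₁) (visit-steps w₁) t≤a a≤L))
              (subst₂ (Walk E (a ∸ t)) (sym eq) at-v (steps-walk′ (visit w₂) (visit-steps w₂) t≤a a≤L)) u↝y v↝y))
              (subst (a ∸ t + b <_) a+b≡L (+-monoˡ-< b (∸-monoʳ-< 0<t t≤a))))
      ... | no t≰a = <-irrefl refl (≤-<-trans (least (mkCollision (m+[n∸m]≡n (≰⇒≥ t≰a)) u≢v x↝u x↝v
              (subst (λ x → Walk E (t ∸ a) x (visit w₁ t)) at-u (steps-walk′ (visit w₁) (visit-steps w₁) (≰⇒≥ t≰a) (<⇒≤ t<L)))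
              (subst₂ (Walk E (t ∸ a)) at-v (sym eq) (steps-walk′ (visit w₂) (visit-steps w₂) (≰⇒≥ t≰a) (<⇒≤ t<L))))) t<L)

-- `¬¬outcome` only refutes the absence of an outcome; the bounded search turns this into an
-- outcome. The shape `r ≡ 0` encodes `exact` and `half`.
outcome? : ∀ n k → Dec (Outcome n k)
outcome? n k = map′ from to (k ≤? n ⊎-dec anyUpTo? (λ p → anyUpTo? (λ r → anyUpTo? (λ q →
    (1 ≤? p) ×-dec (1 ≤? q) ×-dec (p + r + q ≟ n) ×-dec
    (((r ≟ 0) ×-dec ((k ≟ lcm p q) ⊎-dec (k + k ≤? p * q))) ⊎-dec ((1 ≤? r) ×-dec (k ≤? lcm p q + r))))
  (suc n)) (suc n)) (suc n))
  where
  Shape : ℕ → ℕ → ℕ → Set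
  Shape p r q = 1 ≤ p × 1 ≤ q × p + r + q ≡ n ×
                ((r ≡ 0 × (k ≡ lcm p q ⊎ k + k ≤ p * q)) ⊎ (1 ≤ r × k ≤ lcm p q + r))

  Code : Set
  Code = k ≤ n ⊎ ∃ λ p → p < suc n × ∃ λ r → r < suc n × ∃ λ q → q < suc n × Shape p r q

  from : Code → Outcome n k
  from (inj₁ k≤n) = short k≤n
  from (inj₂ (p , _ , _ , _ , q , _ , 1≤p , 1≤q , size , inj₁ (refl , inj₁ eq))) =
    exact p q 1≤p 1≤q (trans (cong (_+ q) (sym (+-identityʳ p))) size) eq
  from (inj₂ (p , _ , _ , _ , q , _ , 1≤p , 1≤q , size , inj₁ (refl , inj₂ le))) =
    half p q 1≤p 1≤q (trans (cong (_+ q) (sym (+-identityʳ p))) size) le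
  from (inj₂ (p , _ , r , _ , q , _ , 1≤p , 1≤q , size , inj₂ (1≤r , le))) = long p r q 1≤p 1≤r 1≤q size le

  shape : ∀ p r q → Shape p r q → Code
  shape p r q sh@(_ , _ , size , _) = inj₂
    (p , s≤s (subst (p ≤_) size (≤-trans (m≤m+n p r) (m≤m+n _ q))) ,
     r , s≤s (subst (r ≤_) size (≤-trans (m≤n+m r p) (m≤m+n _ q))) ,
     q , s≤s (subst (q ≤_) size (m≤n+m q _)) , sh)

  to : Outcome n k → Code
  to (short k≤n)                 = inj₁ k≤n
  to (exact p q 1≤p 1≤q size eq) =
    shape p 0 q (1≤p , 1≤q , trans (cong (_+ q) (+-identityʳ p)) size , inj₁ (refl , inj₁ eq))
  to (half p q 1≤p 1≤q size le)  =
    shape p 0 q (1≤p , 1≤q , trans (cong (_+ q) (+-identityʳ p)) size , inj₁ (refl , inj₂ le))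
  to (long p r q 1≤p 1≤r 1≤q size le) = shape p r q (1≤p , 1≤q , size , inj₂ (1≤r , le))

opaque
  θ-outcome : ∀ {n k} (A : Matrix n) → ZeroOne A → θ A ≡ fin k → Outcome n k
  θ-outcome {n} {k} A A01 eq with θ⇒minCollision A A01 eq
  ... | collision , least = decidable-stable (outcome? n k) (¬¬outcome (edge? A) collision least)

-- Large dumbbells and the set of stable indices

opaque
  lcm-consecutive : ∀ m → lcm m (suc m) ≡ m * suc m
  lcm-consecutive m = trans (sym (*-identityˡ _))
    (trans (cong (_* lcm m (suc m)) (sym (coprime⇒gcd≡1 coprime))) (gcd*lcm m (suc m)))
    where
    coprime : Coprime m (suc m)
    coprime (d∣m , d∣1+m) = ∣1⇒≡1 (∣-difference {b = m} refl d∣1+m d∣m)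

even∨odd : ∀ n → ∃ λ m → n ≡ m + m ⊎ n ≡ suc (m + m)
even∨odd zero = 0 , inj₁ refl
even∨odd (suc n) with even∨odd n
... | m , inj₁ eq = m , inj₂ (cong suc eq)
... | m , inj₂ eq = suc m , inj₁ (trans (cong suc eq) (cong suc (sym (+-suc m m))))

-- A lower bound for the maximum at order `N` that absorbs the outcomes at order `N + 1`: `≥order`
-- serves `short`, and `≥half` serves `half`, where `k + k ≤ p * q` and
-- `4 * (p * q) ≤ (p + q) * (p + q)` combine.
record LargeDumbbell (N : ℕ) : Set where
  field
    p r q  : ℕ
    1≤p    : 1 ≤ p
    1≤q    : 1 ≤ q
    size   : p + r + q ≡ N
    ≥order : N ≤ lcm p q + r
    ≥half  : ∀ k → 8 * k ≤ suc N * suc N → k ≤ lcm p q + r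

opaque
  -- Consecutive cycle lengths are coprime and nearly equal; for even `N` one vertex is left for the
  -- path. The polynomials passed to `m≤m+n` are the differences of the two sides.
  largeDumbbell : ∀ N → 6 ≤ N → LargeDumbbell N
  largeDumbbell N 6≤N with m≤n⇒∃[o]m+o≡n 6≤N
  ... | x , refl with even∨odd x
  ...   | j , inj₁ refl = record
    { p = 2 + j ; r = 1 ; q = 3 + j ; 1≤p = s≤s z≤n ; 1≤q = s≤s z≤n ; size = size j
    ; ≥order = subst (6 + (j + j) ≤_) (trans (sym (order j)) (cong (_+ 1) (sym (lcm-consecutive (2 + j))))) (m≤m+n _ _)
    ; ≥half = λ k 8k≤ → *-cancelˡ-≤ 8 (≤-trans 8k≤ (≤-trans
        (m≤m+n ((7 + (j + j)) * (7 + (j + j))) (4 * j * j + 12 * j + 7))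
        (≤-reflexive (trans (sym (square j)) (cong (λ l → 8 * (l + 1)) (sym (lcm-consecutive (2 + j))))))))
    }
    where
    size : ∀ j → 2 + j + 1 + (3 + j) ≡ 6 + (j + j)
    size = solve-∀
    order : ∀ j → (2 + j) * (3 + j) + 1 ≡ 6 + (j + j) + (j * j + 3 * j + 1)
    order = solve-∀
    square : ∀ j → 8 * ((2 + j) * (3 + j) + 1) ≡ (7 + (j + j)) * (7 + (j + j)) + (4 * j * j + 12 * j + 7)
    square = solve-∀
  ...   | j , inj₂ refl = record
    { p = 3 + j ; r = 0 ; q = 4 + j ; 1≤p = s≤s z≤n ; 1≤q = s≤s z≤n ; size = size j
    ; ≥order = subst (6 + suc (j + j) ≤_) (trans (sym (order j)) (cong (_+ 0) (sym (lcm-consecutive (3 + j))))) (m≤m+n _ _)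
    ; ≥half = λ k 8k≤ → *-cancelˡ-≤ 8 (≤-trans 8k≤ (≤-trans
        (m≤m+n ((7 + suc (j + j)) * (7 + suc (j + j))) (4 * j * j + 24 * j + 32))
        (≤-reflexive (trans (sym (square j)) (cong (λ l → 8 * (l + 0)) (sym (lcm-consecutive (3 + j))))))))
    }
    where
    size : ∀ j → 3 + j + 0 + (4 + j) ≡ 6 + suc (j + j)
    size = solve-∀
    order : ∀ j → (3 + j) * (4 + j) + 0 ≡ 6 + suc (j + j) + (j * j + 5 * j + 5)
    order = solve-∀
    square : ∀ j → 8 * ((3 + j) * (4 + j) + 0) ≡ (7 + suc (j + j)) * (7 + suc (j + j)) + (4 * j * j + 24 * j + 32)
    square = solve-∀

4*≤square : ∀ p q → 4 * (p * q) ≤ (p + q) * (p + q)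
4*≤square p q = [ ordered p q , (λ q≤p → subst₂ _≤_ (cong (4 *_) (*-comm q p)) (cong₂ _*_ (+-comm q p) (+-comm q p)) (ordered q p q≤p)) ]′ (≤-total p q)
  where
  ordered : ∀ p q → p ≤ q → 4 * (p * q) ≤ (p + q) * (p + q)
  ordered p q p≤q with m≤n⇒∃[o]m+o≡n p≤q
  ... | d , refl = subst (4 * (p * (p + d)) ≤_) (sym (expand p d)) (m≤m+n _ _)
    where
    expand : ∀ p d → (p + (p + d)) * (p + (p + d)) ≡ 4 * (p * (p + d)) + d * d
    expand = solve-∀

half⇒8*≤square : ∀ k p q → k + k ≤ p * q → 8 * k ≤ (p + q) * (p + q)
half⇒8*≤square k p q le = ≤-trans (≤-reflexive (double k)) (≤-trans (*-monoʳ-≤ 4 le) (4*≤square p q))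
  where
  double : ∀ k → 8 * k ≡ 4 * (k + k)
  double = solve-∀

-- Any finite stable index, in particular the maximum, is dominated by a dumbbell on all `N`
-- vertices. Adding one vertex to it will realise everything up to `S + 1`.
maximum-dumbbell : ∀ {N S} → 6 ≤ N → Θ N (fin S) → ∃ λ p → ∃₂ λ r q → 1 ≤ p × 1 ≤ q × p + r + q ≡ N × S ≤ lcm p q + r
maximum-dumbbell {N} {S} 6≤N (A , A01 , eq) = bound (θ-outcome A A01 eq)
  where
  open LargeDumbbell (largeDumbbell N 6≤N)

  bound : Outcome N S → ∃ λ p → ∃₂ λ r q → 1 ≤ p × 1 ≤ q × p + r + q ≡ N × S ≤ lcm p q + r
  bound (short le) = p , r , q , 1≤p , 1≤q , size , ≤-trans le ≥order
  bound (exact p q 1≤p 1≤q refl eq) =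
    p , 0 , q , 1≤p , 1≤q , cong (_+ q) (+-identityʳ p) , ≤-trans (≤-reflexive eq) (m≤m+n _ 0)
  -- `≥half` is tuned to order `N + 1`, hence more than enough at order `N`.
  bound (half p′ q′ _ _ refl le) = p , r , q , 1≤p , 1≤q , size ,
    ≥half S (≤-trans (half⇒8*≤square S p′ q′ le) (*-mono-≤ (n≤1+n N) (n≤1+n N)))
  bound (long p r q 1≤p _ 1≤q size le) = p , r , q , 1≤p , 1≤q , size , le

∞∈Θ : ∀ n → Θ n ∞
∞∈Θ n = (λ _ _ → 0ℤ) , (λ _ _ → inj₁ refl) , ¬collision⇒θ≡∞ _ (λ _ _ → inj₁ refl) λ
  { (mkCollision _ u≢v ε       ε _ _) → u≢v refl
  ; (mkCollision _ _   (_ ▷ ()) _ _ _) }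

Θ-suc : ∀ N S → 6 ≤ N → IsMaxFiniteStableIndex N S → Θ (suc N) ≐ [ S + 1 ] ∪ LCMs (suc N) ∪ ｛ ∞ ｝
Θ-suc N S 6≤N (attained , maximal) = necessary , sufficient
  where
  attainable : ∀ {k} → Θ N (fin k) → k ≤ S
  attainable = maximal _

  open LargeDumbbell (largeDumbbell N 6≤N)

  large : lcm p q + r ≤ S
  large = attainable (lcm+r∈Θ p r q 1≤p 1≤q (≤-reflexive size))

  necessary : ∀ {x} → Θ (suc N) x → ([ S + 1 ] ∪ LCMs (suc N) ∪ ｛ ∞ ｝) x
  necessary {∞}     _            = inj₂ (inj₂ refl)
  necessary {fin k} (A , A01 , eq) = classify (θ-outcome A A01 eq)
    where
    1≤k : 1 ≤ k
    1≤k = s≤s⁻¹ (collision-≥2 (proj₁ (θ⇒minCollision A A01 eq)))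

    bounded : k ≤ suc (S) → ([ S + 1 ] ∪ LCMs (suc N) ∪ ｛ ∞ ｝) (fin k)
    bounded le = inj₁ (k , 1≤k , ≤-trans le (≤-reflexive (+-comm 1 (S))) , refl)

    classify : Outcome (suc N) k → ([ S + 1 ] ∪ LCMs (suc N) ∪ ｛ ∞ ｝) (fin k)
    classify (short le) = bounded (≤-trans le (s≤s (≤-trans ≥order large)))
    classify (exact p q 1≤p 1≤q size eq) = inj₂ (inj₁ (p , q , 1≤p , 1≤q , size , cong fin eq))
    classify (half p′ q′ _ _ size le) = bounded (m≤n⇒m≤1+n (≤-trans (≥half k
      (subst (λ n → 8 * k ≤ n * n) size (half⇒8*≤square k p′ q′ le))) large))
    -- Removing one inner vertex leaves a dumbbell of order `N` with index smaller by 1.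
    classify (long p (suc r) q 1≤p _ 1≤q size le) = bounded (≤-trans le (≤-trans (≤-reflexive (+-suc _ r))
      (s≤s (attainable (lcm+r∈Θ p r q 1≤p 1≤q (≤-reflexive (suc-injective (trans (cong (_+ q) (sym (+-suc p r))) size))))))))

  sufficient : ∀ {x} → ([ S + 1 ] ∪ LCMs (suc N) ∪ ｛ ∞ ｝) x → Θ (suc N) x
  sufficient (inj₂ (inj₂ refl)) = ∞∈Θ (suc N)
  sufficient (inj₂ (inj₁ (p , q , 1≤p , 1≤q , size , refl))) =
    subst (λ k → Θ (suc N) (fin k)) (+-identityʳ _)
      (lcm+r∈Θ p 0 q 1≤p 1≤q (≤-reflexive (trans (cong (_+ q) (+-identityʳ p)) size)))
  sufficient (inj₁ (k , 1≤k , k≤s+1 , refl)) with maximum-dumbbell 6≤N attained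
  -- Here `k` is at most `lcm p q + r + 1`. Up to `lcm p q` a drain realises it, since `p + q` is
  -- below `N + 1`; beyond that a dumbbell with at most `r + 1` inner vertices does.
  ... | p , r , q , 1≤p , 1≤q , size , s≤ with k ≤? lcm p q
  ...   | yes k≤lcm = 1≤t≤lcm⇒t∈Θ p q k 1≤p 1≤q
            (s≤s (≤-trans (+-monoˡ-≤ q (m≤m+n p r)) (≤-reflexive size))) 1≤k k≤lcm
  ...   | no  k≰lcm with m≤n⇒∃[o]m+o≡n (≰⇒≥ k≰lcm)
  ...     | r′ , refl = lcm+r∈Θ p r′ q 1≤p 1≤q (≤-trans
            (+-monoˡ-≤ q (+-monoʳ-≤ p (+-cancelˡ-≤ (lcm p q) r′ (suc r)
              (≤-trans k≤s+1 (≤-trans (≤-reflexive (+-comm (S) 1)) (≤-trans (s≤s s≤) (≤-reflexive (sym (+-suc _ r)))))))))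
            (≤-reflexive (trans (cong (_+ q) (+-suc p r)) (cong suc size))))

theorem3 : (n : ℕ) → 7 ≤ n → Θ n ≐ [ s (n ∸ 1) + 1 ] ∪ LCMs n ∪ ｛ ∞ ｝
theorem3 (suc N) (s≤s 6≤N) = Θ-suc N (s N) 6≤N (s-isMaximum N (≤-trans (s≤s (s≤s z≤n)) 6≤N))
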